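{- Let $\kappa$ be a positive integer with $\kappa\le4$, let $n=\kappa^2+1$, and let $A$ be an $n\times n$ $(0,1)$-matrix with all row and column sums equal to $\kappa$ such that $\Theta^m(A)=A$ for some integer $m\ge1$. Then: (i) $A$ is p-equivalent to a standard form $S(P)$ in which each block $P_{ij}$ ($1\le i,j\le\kappa$) of $P$ is a $(0,1)$-matrix with at most one entry $1$ in each row and in each column; (ii) for such a $P$, if some block $P_{ij}$ is the zero matrix, then all other blocks $P_{ij'}$ ($j'\neq j$) in the same block row and all other blocks $P_{i'j}$ ($i'\ne i$) in the same block column are permutation matrices; (iii) if such a $P$ has a zero block on its block diagonal, then $A$ is p-equivalent to a standard form $S(P')$ with $P'_{11}$ the zero matrix of order $\kappa-1$ and $P'_{1i}=P'_{i1}=I_{\kappa-1}$ for all $i=2,\dots,\kappa$.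
   Context: For an $n\times n$ integer matrix $X$ whose row and column sums all equal an integer $\lambda$, define $\Theta(X):=(\lambda-1)I_n+J_n-XX^{\mathrm T}$, where $I_n$ is the identity and $J_n$ the all-one matrix of order $n$; $\Theta(X)$ again has constant row and column sums, and $\Theta^m$ denotes the $m$-fold iterate, each application using the common row/column sum of its argument. Matrices $M_1,M_2$ of order $r$ are p-equivalent if $M_2=S^{ -1}M_1S$ for a permutation matrix $S$. Let $\mathbf{0}_\nu,\mathbf{1}_\nu$ be the all-zero and all-one row vectors of length $\nu$, $\mathbf{0}_{\kappa,\kappa}$ the zero matrix of order $\kappa$, and $K=I_\kappa\otimes\mathbf{1}_{\kappa-1}$ (a $\kappa\times(\kappa^2-\kappa)$ matrix whose $i$-th row has ones exactly in columns $(i-1)(\kappa-1)+1,\dots,i(\kappa-1)$). A standard form is a matrix $$S(P)=\begin{pmatrix}0&\mathbf{1}_\kappa&\mathbf{0}_{\kappa^2-\kappa}\\ \mathbf{1}_\kappa^{\mathrm T}&\mathbf{0}_{\kappa,\kappa}&K\\ \mathbf{0}_{\kappa^2-\kappa}^{\mathrm T}&K^{\mathrm T}&P\end{pmatrix}$$ where $P$ is a symmetric $(0,1)$-matrix of order $\kappa^2-\kappa$ with all row and column sums equal to $\kappa-1$, regarded as a $\kappa\times\kappa$ block matrix $P=(P_{ij})$ with square blocks of order $\kappa-1$. -}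

module Defs where

open import Data.Nat as ℕ using (ℕ; zero; suc)
open import Data.Integer as ℤ using (ℤ; +_; 0ℤ; 1ℤ)
open import Data.Fin using (Fin; zero; suc; _≟_)
open import Data.Unit using (⊤; tt)
open import Data.Sum using (_⊎_; inj₁; inj₂)
open import Data.Product using (_×_; _,_; Σ; ∃; ∃-syntax)
open import Relation.Binary.PropositionalEquality using (_≡_; _≢_)
open import Relation.Nullary.Decidable using (⌊_⌋)
open import Data.Bool using (if_then_else_)
open import Function.Bundles using (_↔_; Inverse)

Mat : Set → Set
Mat I = I → I → ℤ

∑ : (n : ℕ) → (Fin n → ℤ) → ℤ
∑ zero    f = 0ℤ
∑ (suc n) f = f zero ℤ.+ ∑ n (λ i → f (suc i))

δ : {n : ℕ} → Fin n → Fin n → ℤ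
δ a b = if ⌊ a ≟ b ⌋ then 1ℤ else 0ℤ

Is01 : ℤ → Set
Is01 x = (x ≡ 0ℤ) ⊎ (x ≡ 1ℤ)

-- Θ(X) = (λ-1) I + J - X Xᵀ, where λ is the common row sum of X,
-- read off from the first row (order n = suc r ≥ 1).
Θ : {r : ℕ} → Mat (Fin (suc r)) → Mat (Fin (suc r))
Θ {r} X i j = ((lam ℤ.- 1ℤ) ℤ.* δ i j ℤ.+ 1ℤ) ℤ.- ∑ (suc r) (λ k → X i k ℤ.* X j k)
  where lam = ∑ (suc r) (X zero)

Θ^ : {r : ℕ} → ℕ → Mat (Fin (suc r)) → Mat (Fin (suc r))
Θ^ zero    X = X
Θ^ (suc m) X = Θ (Θ^ m X)

-- Standard forms.  Throughout κ = suc k, so κ - 1 = k.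
-- P (of order κ²-κ) is given in block form: P i a j b is entry (a,b)
-- of block P_ij, i.e. entry ((i-1)(κ-1)+a, (j-1)(κ-1)+b) of P.

BlockMat : ℕ → Set
BlockMat k = Fin (suc k) → Fin k → Fin (suc k) → Fin k → ℤ

-- Row/column index set of S(P), of size 1 + κ + (κ²-κ) = κ²+1,
-- in the order of the block decomposition of S(P).
Idx : ℕ → Set
Idx k = ⊤ ⊎ (Fin (suc k) ⊎ (Fin (suc k) × Fin k))

-- K = I_κ ⊗ 1_{κ-1}
Kmat : {k : ℕ} → Fin (suc k) → Fin (suc k) × Fin k → ℤ
Kmat i (j , _) = δ i j

S : {k : ℕ} → BlockMat k → Mat (Idx k)
S P (inj₁ _)        (inj₁ _)               = 0ℤ
S P (inj₁ _)        (inj₂ (inj₁ _))        = 1ℤ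
S P (inj₁ _)        (inj₂ (inj₂ _))        = 0ℤ
S P (inj₂ (inj₁ _)) (inj₁ _)               = 1ℤ
S P (inj₂ (inj₁ _)) (inj₂ (inj₁ _))        = 0ℤ
S P (inj₂ (inj₁ i)) (inj₂ (inj₂ q))        = Kmat i q
S P (inj₂ (inj₂ _)) (inj₁ _)               = 0ℤ
S P (inj₂ (inj₂ q)) (inj₂ (inj₁ i))        = Kmat i q
S P (inj₂ (inj₂ (i , a))) (inj₂ (inj₂ (j , b))) = P i a j b

IsStdP : {k : ℕ} → BlockMat k → Set
IsStdP {k} P =
  (∀ i a j b → Is01 (P i a j b)) ×
  (∀ i a j b → P i a j b ≡ P j b i a) ×
  (∀ i a → ∑ (suc k) (λ j → ∑ k (λ b → P i a j b)) ≡ + k) ×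
  (∀ j b → ∑ (suc k) (λ i → ∑ k (λ a → P i a j b)) ≡ + k)

PEquiv : {n k : ℕ} → Mat (Fin n) → Mat (Idx k) → Set
PEquiv {n} {k} M₁ M₂ =
  Σ (Fin n ↔ Idx k) λ σ → ∀ i j → M₁ i j ≡ M₂ (Inverse.to σ i) (Inverse.to σ j)

BlocksPartialPerm : {k : ℕ} → BlockMat k → Set
BlocksPartialPerm P =
  (∀ i j a b b′ → P i a j b ≡ 1ℤ → P i a j b′ ≡ 1ℤ → b ≡ b′) ×
  (∀ i j a a′ b → P i a j b ≡ 1ℤ → P i a′ j b ≡ 1ℤ → a ≡ a′)

ZeroBlock : {k : ℕ} → BlockMat k → Fin (suc k) → Fin (suc k) → Set
ZeroBlock P i j = ∀ a b → P i a j b ≡ 0ℤ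

IdBlock : {k : ℕ} → BlockMat k → Fin (suc k) → Fin (suc k) → Set
IdBlock P i j = ∀ a b → P i a j b ≡ δ a b

IsPermMat : {m : ℕ} → (Fin m → Fin m → ℤ) → Set
IsPermMat {m} M = Σ (Fin m ↔ Fin m) λ π → ∀ a b → M a b ≡ δ (Inverse.to π a) b

{-# OPTIONS --safe #-}
-- The diagonal of Θ(X) is κ - Σ x² over the rows of X, while Σ x = κ and x² ≥ x
-- for integers with equality only for 0 and 1.  Hence if Θ(X) is a (0,1)-matrix,
-- then so is X, and by periodicity all iterates of A are.  So A is the adjacency
-- matrix of a κ-regular graph on κ² + 1 vertices; as Θ(A) has entries 0 and 1, it
-- has no squares, and as Θ²(A) has, nor does Θ(A), the graph joining the vertices
-- of A that are distinct and have no common neighbour.  A vertex in no triangle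
-- then has κ + κ(κ-1) distinct vertices within distance two, which yields S(P).
--
-- That such a vertex exists for κ ≤ 4 is decided by exhaustive search.  For κ = 4
-- the search is run twice: first assuming that some vertex lies in two triangles,
-- and then with the knowledge that every vertex lies in exactly one.
module Submission where

open import Defs
open import Data.Bool.Base using (Bool; true; false; _∧_; _∨_; not; if_then_else_; T)
open import Data.Bool.Properties using (T?; T-∧; T-∨; T-≡)
open import Data.Empty using (⊥; ⊥-elim)
open import Data.Unit.Base using (tt)
open import Data.Nat.Base using (ℕ; zero; suc; _+_; _*_; _∸_; _≤_; _<_; _≤ᵇ_; _<ᵇ_; z≤n; s≤s; s≤s⁻¹)
open import Data.Nat.Properties as ℕ using (_<?_; ≤ᵇ⇒≤; ≤⇒≤ᵇ; <ᵇ⇒<; <⇒<ᵇ)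
open import Data.Integer.Base as ℤ using (ℤ; +_; -[1+_]; 0ℤ; 1ℤ)
import Data.Integer.Properties as ℤ
open import Data.Integer.Tactic.RingSolver using (solve-∀)
open import Data.Fin.Base using (Fin; zero; suc; toℕ; fromℕ<; inject≤; punchIn; punchOut; splitAt; remQuot)
open import Data.Fin.Patterns using (0F; 1F; 2F; 3F; 4F)
open import Data.Fin.Properties as Fin using (_≟_)
open import Data.Fin.Permutation as Perm using (Permutation; _⟨$⟩ʳ_; _⟨$⟩ˡ_; inverseˡ; inverseʳ; transpose; insert; insert-punchIn)
open import Data.Vec.Base using (Vec; []; _∷_; lookup; map; zipWith; replicate; tabulate; _[_]≔_; updateAt)
open import Data.Vec.Properties using (lookup-map; lookup-zipWith; lookup-replicate; lookup∘tabulate; lookup∘update; lookup∘update′; lookup∘updateAt; lookup∘updateAt′)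
open import Data.Vec.Relation.Unary.All using ([]; _∷_)
open import Data.Vec.Relation.Unary.AllPairs using ([]; _∷_)
open import Data.Vec.Relation.Unary.Unique.Propositional using (Unique)
open import Data.Vec.Relation.Unary.Unique.Propositional.Properties using (lookup-injective)
open import Data.List.Base using (List; []; _∷_; filterᵇ; allFin; foldr)
open import Data.List.Extrema.Nat using (argmin; argmin-all)
open import Data.List.Membership.Propositional using (_∈_)
open import Data.List.Membership.Propositional.Properties using (∈-filter⁺; ∈-allFin)
open import Data.List.Relation.Unary.All as All using (All; []; _∷_)
open import Data.List.Relation.Unary.All.Properties using (all-filter)
open import Data.List.Relation.Unary.Any using (here; there)
open import Data.Product.Base using (_×_; _,_; Σ; ∃; ∃₂; proj₁; proj₂; map₁)
open import Data.Sum.Base using (_⊎_; inj₁; inj₂; [_,_]′) renaming (map to ⊎-map)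
open import Data.Sum.Function.Propositional using (_⊎-↔_)
open import Function.Base using (_∘_)
open import Function.Bundles using (Equivalence; Inverse; _↔_; mk↔ₛ′)
open import Function.Definitions using (Injective)
open import Function.Properties.Inverse using (↔-refl; ↔-sym; ↔-trans)
open import Relation.Nullary using (¬_; Dec; yes; no; contradiction)
open import Relation.Nullary.Decidable using (_×-dec_; ¬?; decidable-stable; ⌊_⌋; toWitness; fromWitness)
open import Relation.Binary.PropositionalEquality using (_≡_; _≢_; refl; sym; trans; cong; cong₂; subst; subst₂; ≢-sym; module ≡-Reasoning)
open import Algebra.Properties.AbelianGroup ℤ.+-0-abelianGroup using (∙-cancelˡ)
open import Algebra.Properties.CommutativeMonoid.Sum ℕ.+-0-commutativeMonoid using (sum; sum-permute)
open import Algebra.Properties.Semiring.Sum ℤ.+-*-semiring as ℤSum using ()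

-- The bound κ ≤ 4 enters only through the existence of a triangle-free vertex; the rest is uniform
-- in κ. There are exactly 1 + κ + κ(κ-1) = κ² + 1 vertices, so once the vertices within distance
-- two of such a vertex are distinct, they exhaust the graph and injectivity already gives the
-- bijection with `Idx k`.
--
-- The search has to be sound but not exact. From the known edges it computes an upper bound
-- `possible` on the adjacency. Vertices whose possible neighbourhoods are disjoint are certainly
-- `Far`, so the same bound yields a lower bound on `Far`, and squares in the far graph can be
-- detected long before the graph is complete. Squares in the graph itself are never built, because
-- an edge closing a known walk of length 3 is excluded from `possible`.
--
-- For κ = 4 the exclusion of two triangles at a vertex pays off as a pruning rule: an edge that
-- would create a second triangle at some vertex may then be discarded as well.

private variable m n : ℕ

-- Boolean rows and matrices

-- Expressed by `sum` so that `sum-permute` shows degrees to be invariant under relabelling; `∣_∣`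
-- is its counterpart for the rows that the search computes with.
size : (Fin n → Bool) → ℕ
size p = sum (λ i → if p i then 1 else 0)

Row : ℕ → Set
Row = Vec Bool

Matrix : ℕ → Set
Matrix n = Vec (Row n) n

infix 4 _∋_
_∋_ : Row n → Fin n → Set
r ∋ i = T (lookup r i)

infixr 7 _∩_
infixr 6 _∪_

-- These operations are evaluated by the type checker during the search, so they branch on the first
-- row and leave an entry of the second row unexamined when the first decides.
_∩_ : Row n → Row n → Row n
[]          ∩ []      = []
(true  ∷ r) ∩ (y ∷ s) = y ∷ (r ∩ s)
(false ∷ r) ∩ (_ ∷ s) = false ∷ (r ∩ s)

_∪_ : Row n → Row n → Row n
[]          ∪ []      = []
(true  ∷ r) ∪ (_ ∷ s) = true ∷ (r ∪ s)
(false ∷ r) ∪ (y ∷ s) = y ∷ (r ∪ s)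

∁ : Row n → Row n
∁ = map not

∣_∣ : Row n → ℕ
∣ [] ∣        = 0
∣ true  ∷ r ∣ = suc ∣ r ∣
∣ false ∷ r ∣ = ∣ r ∣

any : Row n → Bool
any []      = false
any (x ∷ r) = x ∨ any r

meets : Row n → Row n → Bool
meets r s = any (r ∩ s)

⋃ : Row m → Vec (Row n) m → Row n
⋃ []          []       = replicate _ false
⋃ (true  ∷ s) (r ∷ rs) = r ∪ ⋃ s rs
⋃ (false ∷ s) (_ ∷ rs) = ⋃ s rs

guard : Bool → Row n → Row n
guard true  r = r
guard false _ = replicate _ false

guard⁻ : ∀ b (r : Row n) i → guard b r ∋ i → T b × r ∋ i
guard⁻ true  r i h = tt , h
guard⁻ false r i h = ⊥-elim (subst T (lookup-replicate i false) h)

∩⁻ : ∀ (r s : Row n) i → r ∩ s ∋ i → r ∋ i × s ∋ i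
∩⁻ (true  ∷ r) (y ∷ s) zero    h = tt , h
∩⁻ (true  ∷ r) (y ∷ s) (suc i) h = ∩⁻ r s i h
∩⁻ (false ∷ r) (y ∷ s) (suc i) h = ∩⁻ r s i h

∩⁺ : ∀ (r s : Row n) i → r ∋ i → s ∋ i → r ∩ s ∋ i
∩⁺ (true  ∷ r) (y ∷ s) zero    _ k = k
∩⁺ (true  ∷ r) (y ∷ s) (suc i) h k = ∩⁺ r s i h k
∩⁺ (false ∷ r) (y ∷ s) (suc i) h k = ∩⁺ r s i h k

∪⁻ : ∀ (r s : Row n) i → r ∪ s ∋ i → r ∋ i ⊎ s ∋ i
∪⁻ (true  ∷ r) (y ∷ s) zero    h = inj₁ tt
∪⁻ (false ∷ r) (y ∷ s) zero    h = inj₂ h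
∪⁻ (true  ∷ r) (y ∷ s) (suc i) h = ∪⁻ r s i h
∪⁻ (false ∷ r) (y ∷ s) (suc i) h = ∪⁻ r s i h

∪⁺ˡ : ∀ (r s : Row n) i → r ∋ i → r ∪ s ∋ i
∪⁺ˡ (true  ∷ r) (y ∷ s) zero    _ = tt
∪⁺ˡ (true  ∷ r) (y ∷ s) (suc i) h = ∪⁺ˡ r s i h
∪⁺ˡ (false ∷ r) (y ∷ s) (suc i) h = ∪⁺ˡ r s i h

∪⁺ʳ : ∀ (r s : Row n) i → s ∋ i → r ∪ s ∋ i
∪⁺ʳ (true  ∷ r) (y ∷ s) zero    _ = tt
∪⁺ʳ (false ∷ r) (y ∷ s) zero    h = h
∪⁺ʳ (true  ∷ r) (y ∷ s) (suc i) h = ∪⁺ʳ r s i h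
∪⁺ʳ (false ∷ r) (y ∷ s) (suc i) h = ∪⁺ʳ r s i h

T-not⁻ : ∀ {x} → T (not x) → ¬ T x
T-not⁻ {false} _ ()

T-not⁺ : ∀ {x} → ¬ T x → T (not x)
T-not⁺ {true}  h = h tt
T-not⁺ {false} _ = tt

∁⁺ : ∀ (r : Row n) i → ¬ r ∋ i → ∁ r ∋ i
∁⁺ r i h = subst T (sym (lookup-map i not r)) (T-not⁺ h)

any⁻ : ∀ (r : Row n) → T (any r) → ∃ λ i → r ∋ i
any⁻ (true  ∷ r) _ = zero , tt
any⁻ (false ∷ r) h = let i , p = any⁻ r h in suc i , p

any⁺ : ∀ (r : Row n) i → r ∋ i → T (any r)
any⁺ (true  ∷ r) _       _ = tt
any⁺ (false ∷ r) (suc i) h = any⁺ r i h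

any-map⁻ : ∀ {A : Set} (f : A → Bool) (xs : Vec A n) → T (any (map f xs)) → ∃ λ i → T (f (lookup xs i))
any-map⁻ f xs h = let i , p = any⁻ (map f xs) h in i , subst T (lookup-map i f xs) p

meets⁻ : ∀ (r s : Row n) → T (meets r s) → ∃ λ i → r ∋ i × s ∋ i
meets⁻ r s h = let i , p = any⁻ (r ∩ s) h in i , ∩⁻ r s i p

meets⁺ : ∀ (r s : Row n) i → r ∋ i → s ∋ i → T (meets r s)
meets⁺ r s i p q = any⁺ (r ∩ s) i (∩⁺ r s i p q)

⋃⁻ : ∀ (s : Row m) (rs : Vec (Row n) m) j → ⋃ s rs ∋ j → ∃ λ i → s ∋ i × lookup rs i ∋ j
⋃⁻ []          []       j h = ⊥-elim (subst T (lookup-replicate j false) h)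
⋃⁻ (true  ∷ s) (r ∷ rs) j h with ∪⁻ r (⋃ s rs) j h
... | inj₁ p = zero , tt , p
... | inj₂ p = let i , q , t = ⋃⁻ s rs j p in suc i , q , t
⋃⁻ (false ∷ s) (_ ∷ rs) j h = let i , q , t = ⋃⁻ s rs j h in suc i , q , t

two-members : ∀ (r : Row n) → 2 ≤ ∣ r ∣ → ∃₂ λ i j → i ≢ j × r ∋ i × r ∋ j
two-members (false ∷ r) h = let i , j , i≢j , p , q = two-members r h in
  suc i , suc j , i≢j ∘ Fin.suc-injective , p , q
two-members (true  ∷ r) (s≤s h) = let i , p = member r h in zero , suc i , (λ ()) , tt , p
  where
  member : ∀ {n} (r : Row n) → 1 ≤ ∣ r ∣ → ∃ λ i → r ∋ i
  member (true  ∷ r) _ = zero , tt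
  member (false ∷ r) h = let i , p = member r h in suc i , p

size≤∣∣ : ∀ (p : Fin n → Bool) r → (∀ i → T (p i) → r ∋ i) → size p ≤ ∣ r ∣
size≤∣∣ p []          h = z≤n
size≤∣∣ p (x ∷ r)     h with p zero | h zero
size≤∣∣ p (true  ∷ r) h | true  | _ = s≤s (size≤∣∣ (p ∘ suc) r (h ∘ suc))
size≤∣∣ p (false ∷ r) h | true  | c = ⊥-elim (c tt)
size≤∣∣ p (true  ∷ r) h | false | _ = ℕ.m≤n⇒m≤1+n (size≤∣∣ (p ∘ suc) r (h ∘ suc))
size≤∣∣ p (false ∷ r) h | false | _ = size≤∣∣ (p ∘ suc) r (h ∘ suc)

∣∣≤size : ∀ (p : Fin n → Bool) r → (∀ i → r ∋ i → T (p i)) → ∣ r ∣ ≤ size p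
∣∣≤size p []          h = z≤n
∣∣≤size p (x ∷ r)     h with p zero | h zero
∣∣≤size p (true  ∷ r) h | true  | _ = s≤s (∣∣≤size (p ∘ suc) r (h ∘ suc))
∣∣≤size p (true  ∷ r) h | false | c = ⊥-elim (c tt)
∣∣≤size p (false ∷ r) h | true  | _ = ℕ.m≤n⇒m≤1+n (∣∣≤size (p ∘ suc) r (h ∘ suc))
∣∣≤size p (false ∷ r) h | false | _ = ∣∣≤size (p ∘ suc) r (h ∘ suc)

∣∣<size : ∀ (p : Fin n → Bool) r → (∀ i → r ∋ i → T (p i)) → ∀ i → T (p i) → ¬ r ∋ i → ∣ r ∣ < size p
∣∣<size p (true  ∷ r) h zero    pi r∌i = ⊥-elim (r∌i tt)
∣∣<size p (false ∷ r) h zero    pi r∌i with p zero | pi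
... | true | _ = s≤s (∣∣≤size (p ∘ suc) r (h ∘ suc))
∣∣<size p (x ∷ r)     h (suc i) pi r∌i with p zero | h zero
∣∣<size p (true  ∷ r) h (suc i) pi r∌i | true  | _ = s≤s (∣∣<size (p ∘ suc) r (h ∘ suc) i pi r∌i)
∣∣<size p (true  ∷ r) h (suc i) pi r∌i | false | c = ⊥-elim (c tt)
∣∣<size p (false ∷ r) h (suc i) pi r∌i | true  | _ = ℕ.m≤n⇒m≤1+n (∣∣<size (p ∘ suc) r (h ∘ suc) i pi r∌i)
∣∣<size p (false ∷ r) h (suc i) pi r∌i | false | _ = ∣∣<size (p ∘ suc) r (h ∘ suc) i pi r∌i

∣∣<size⇒missing : ∀ (p : Fin n → Bool) r → ∣ r ∣ < size p → ∃ λ i → T (p i) × ¬ r ∋ i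
∣∣<size⇒missing p (x ∷ r)     h with p zero in eq
∣∣<size⇒missing p (true  ∷ r) h | true  = let i , a , b = ∣∣<size⇒missing (p ∘ suc) r (s≤s⁻¹ h) in suc i , a , b
∣∣<size⇒missing p (false ∷ r) h | true  = zero , Equivalence.from T-≡ eq , λ ()
∣∣<size⇒missing p (true  ∷ r) h | false = let i , a , b = ∣∣<size⇒missing (p ∘ suc) r (ℕ.<-trans (ℕ.n<1+n _) h) in suc i , a , b
∣∣<size⇒missing p (false ∷ r) h | false = let i , a , b = ∣∣<size⇒missing (p ∘ suc) r h in suc i , a , b

mark : Fin n → Fin n → Matrix n → Matrix n
mark u v M = updateAt (updateAt M u (_[ v ]≔ true)) v (_[ u ]≔ true)

identity none : ∀ n → Matrix n
identity n = tabulate λ i → replicate n false [ i ]≔ true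
none n = replicate n (replicate n false)

entry : Matrix n → Fin n → Fin n → Set
entry M u v = lookup M u ∋ v

none⁻ : ∀ (u v : Fin n) → ¬ entry (none n) u v
none⁻ {n} u v h rewrite lookup-replicate u (replicate n false) | lookup-replicate v false = h

identity⁻ : ∀ {u v : Fin n} → entry (identity n) u v → u ≡ v
identity⁻ {n} {u} {v} h with u ≟ v
... | yes eq = eq
... | no u≢v = ⊥-elim (subst T (trans (cong (λ r → lookup r v) (lookup∘tabulate (λ i → replicate n false [ i ]≔ true) u))
                 (trans (lookup∘update′ (≢-sym u≢v) (replicate n false) true) (lookup-replicate v false))) h)

set⁻ : ∀ {u v a b : Fin n} {M} → entry (updateAt M u (_[ v ]≔ true)) a b → (a ≡ u × b ≡ v) ⊎ entry M a b
set⁻ {u = u} {v} {a} {b} {M} h with a ≟ u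
... | no a≢u = inj₂ (subst (_∋ b) (lookup∘updateAt′ a u a≢u M) h)
... | yes refl with b ≟ v
...   | yes eq = inj₁ (refl , eq)
...   | no b≢v = inj₂ (subst T (trans (cong (λ r → lookup r b) (lookup∘updateAt u M)) (lookup∘update′ b≢v (lookup M u) true)) h)

set⁺ : ∀ {u v : Fin n} {M} → entry (updateAt M u (_[ v ]≔ true)) u v
set⁺ {u = u} {v} {M} = subst T (sym (trans (cong (λ r → lookup r v) (lookup∘updateAt u M)) (lookup∘update v (lookup M u) true))) tt

set-⊆ : ∀ {u v a b : Fin n} {M} → entry M a b → entry (updateAt M u (_[ v ]≔ true)) a b
set-⊆ {u = u} {v} {a} {b} {M} h with a ≟ u
... | no a≢u = subst (_∋ b) (sym (lookup∘updateAt′ a u a≢u M)) h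
... | yes refl with b ≟ v
...   | yes refl = set⁺ {M = M}
...   | no b≢v = subst T (sym (trans (cong (λ r → lookup r b) (lookup∘updateAt u M)) (lookup∘update′ b≢v (lookup M u) true))) h

mark⁻ : ∀ {u v a b : Fin n} {M} → entry (mark u v M) a b → (a ≡ u × b ≡ v) ⊎ (a ≡ v × b ≡ u) ⊎ entry M a b
mark⁻ {u = u} {v} {a} {b} {M} h with set⁻ {M = updateAt M u (_[ v ]≔ true)} h
... | inj₁ e = inj₂ (inj₁ e)
... | inj₂ h′ with set⁻ {M = M} h′
...   | inj₁ e = inj₁ e
...   | inj₂ h″ = inj₂ (inj₂ h″)

mark-symmetric : ∀ (u v : Fin n) {M} → (∀ {a b} → entry M a b → entry M b a) →
                 ∀ {a b} → entry (mark u v M) a b → entry (mark u v M) b a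
mark-symmetric u v {M} s {a} {b} h with mark⁻ {M = M} h
... | inj₁ (refl , refl)        = set⁺ {M = updateAt M u (_[ v ]≔ true)}
... | inj₂ (inj₁ (refl , refl)) = set-⊆ {M = updateAt M u (_[ v ]≔ true)} (set⁺ {M = M})
... | inj₂ (inj₂ h′)            = set-⊆ {M = updateAt M u (_[ v ]≔ true)} (set-⊆ {M = M} (s h′))

-- Regular graphs without squares, whose "no common neighbour" graph has none either

record Graph (n D : ℕ) : Set where
  field
    adj : Fin n → Fin n → Bool

  infix 4 _~_
  _~_ : Fin n → Fin n → Set
  u ~ v = T (adj u v)

  Far : Fin n → Fin n → Set
  Far u v = u ≢ v × (∀ c → u ~ c → v ~ c → ⊥)

  field
    ~-sym      : ∀ {u v} → u ~ v → v ~ u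
    ~-irrefl   : ∀ {v} → ¬ v ~ v
    regular    : ∀ v → size (adj v) ≡ D
    noSquare    : ∀ {u v x y} → u ≢ v → x ≢ y → u ~ x → u ~ y → v ~ x → v ~ y → ⊥
    noFarSquare : ∀ {u v x y} → u ≢ v → x ≢ y → Far u x → Far u y → Far v x → Far v y → ⊥

  Triangle : Fin n → Fin n → Fin n → Set
  Triangle u v w = u ~ v × u ~ w × v ~ w

  triangle? : ∀ u v w → Dec (Triangle u v w)
  triangle? u v w = T? _ ×-dec T? _ ×-dec T? _

  Triangulated : Set
  Triangulated = ∀ v → ∃₂ (Triangle v)

  -- Comparing `c` alone suffices: exchanging `c` and `d` in the second triangle gives the same for
  -- `d`.
  Single : Set
  Single = ∀ {v a b c d} → Triangle v a b → Triangle v c d → c ≡ a ⊎ c ≡ b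

to-injective : ∀ {A B : Set} (σ : A ↔ B) → Injective _≡_ _≡_ (Inverse.to σ)
to-injective σ eq = trans (sym (Inverse.strictlyInverseʳ σ _)) (trans (cong (Inverse.from σ) eq) (Inverse.strictlyInverseʳ σ _))

module _ {D} (π : Permutation n n) (G : Graph n D) where
  open Graph G

  relabel : Graph n D
  relabel = record
    { adj         = λ u v → adj (π ⟨$⟩ʳ u) (π ⟨$⟩ʳ v)
    ; ~-sym       = ~-sym
    ; ~-irrefl    = ~-irrefl
    ; regular     = λ v → trans (sym (sum-permute (λ i → if adj (π ⟨$⟩ʳ v) i then 1 else 0) π)) (regular (π ⟨$⟩ʳ v))
    ; noSquare    = λ u≢v x≢y → noSquare (u≢v ∘ to-injective π) (x≢y ∘ to-injective π)
    ; noFarSquare = λ u≢v x≢y p q r s → noFarSquare (u≢v ∘ to-injective π) (x≢y ∘ to-injective π)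
                      (far p) (far q) (far r) (far s)
    }
    where
    far : ∀ {u v} → u ≢ v × (∀ c → π ⟨$⟩ʳ u ~ π ⟨$⟩ʳ c → π ⟨$⟩ʳ v ~ π ⟨$⟩ʳ c → ⊥) → Far (π ⟨$⟩ʳ u) (π ⟨$⟩ʳ v)
    far (u≢v , h) = u≢v ∘ to-injective π , λ c p q →
      h (π ⟨$⟩ˡ c) (subst (_ ~_) (sym (inverseʳ π)) p) (subst (_ ~_) (sym (inverseʳ π)) q)

  relabel-triangulated : Triangulated → Graph.Triangulated relabel
  relabel-triangulated tri v with tri (π ⟨$⟩ʳ v)
  ... | a , b , va , vb , ab = π ⟨$⟩ˡ a , π ⟨$⟩ˡ b ,
    subst (_ ~_) (sym (inverseʳ π)) va , subst (_ ~_) (sym (inverseʳ π)) vb ,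
    subst₂ _~_ (sym (inverseʳ π)) (sym (inverseʳ π)) ab

  relabel-single : Single → Graph.Single relabel
  relabel-single single t t′ = ⊎-map (to-injective π) (to-injective π) (single t t′)

-- Exhaustive search over partial graphs

-- A state consists of the known edges Y, the known non-edges X and a number k:
-- apart from the diagonal of X, only labels below k occur in Y and X, so the
-- labels from k on are interchangeable and a new vertex may always be given the label k.
module Search {n : ℕ} (D : ℕ) (single : Bool) where

  -- The vertices w whose adjacency to v would put v, w or a common neighbour
  -- of the two into a second triangle; W₂ v collects the known walks of length 2
  -- from v, and R the vertices known to lie in a triangle.
  secondTriangle : Matrix n → Matrix n → Row n → Fin n → Row n
  secondTriangle Y W₂ R v =
    if lookup R v then lookup W₂ v
    else lookup W₂ v ∩ R ∪ ⋃ (lookup Y v ∩ R) Y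

  -- A known walk of length 3 from v to w (collected in W₃) would be closed to a
  -- square by an edge; F holds the vertices that already have D neighbours.
  forbidden : Matrix n → Matrix n → Matrix n → Matrix n → Row n → Row n → Fin n → Row n
  forbidden Y X W₂ W₃ F R v =
    lookup X v ∪ lookup W₃ v ∪ F ∪ guard single (secondTriangle Y W₂ R v)

  options : Matrix n → Matrix n → Matrix n → Matrix n → Row n → Row n → Fin n → Row n
  options Y X W₂ W₃ F R v =
    if lookup F v then lookup Y v else lookup Y v ∪ ∁ (forbidden Y X W₂ W₃ F R v)

  -- The intermediate matrices are passed as arguments because, unlike local
  -- definitions, arguments are shared during evaluation.
  possible : Matrix n → Matrix n → Matrix n
  possible Y X = with₂ (map (λ y → ⋃ y Y) Y)
    where
    withAll : Matrix n → Matrix n → Row n → Row n → Matrix n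
    withAll W₂ W₃ F R = tabulate (options Y X W₂ W₃ F R)

    with₂ : Matrix n → Matrix n
    with₂ W₂ = withAll W₂ (map (λ y → ⋃ y W₂) Y) (map (λ y → D ≤ᵇ ∣ y ∣) Y) (zipWith meets Y W₂)

  -- In a symmetric matrix such as `apart P`, two rows that share an entry a both belong to vertices
  -- listed in row a. Hence comparing the pairs within each row finds every square.
  clash : Row m → Vec (Row n) m → Bool
  clash []      []       = false
  clash (x ∷ r) (q ∷ qs) = (x ∧ any (zipWith (λ y q′ → y ∧ (2 ≤ᵇ ∣ q ∩ q′ ∣)) r qs)) ∨ clash r qs

  clashes : Matrix n → Bool
  clashes Q = any (map (λ q → clash q Q) Q)

  -- Disjoint upper bounds on two neighbourhoods leave no common neighbour, so every pair listed
  -- here is certainly `Far`.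
  apart : Matrix n → Matrix n
  apart P = map (λ p → map (λ q → not (meets p q)) P) P

  -- The three tests contradict, in turn, regularity, the assumption that every vertex lies in a
  -- triangle, and `noFarSquare`.
  refuted : Matrix n → Bool
  refuted P = any (map (λ p → not (D ≤ᵇ ∣ p ∣)) P)
            ∨ any (map (λ p → not (any (p ∩ map (meets p) P))) P)
            ∨ clashes (apart P)

  unsaturated : Matrix n → ℕ → List (Fin n)
  unsaturated Y k = filterᵇ (λ v → (toℕ v <ᵇ k) ∧ (∣ lookup Y v ∣ <ᵇ D)) (allFin n)

  candidates : Row n → Row n → ℕ → List (Fin n)
  candidates y p k = filterᵇ (λ w → (toℕ w <ᵇ k) ∧ lookup (p ∩ ∁ y) w) (allFin n)

  -- Branching on few options and many known neighbours keeps the tree small.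
  weight : Matrix n → Matrix n → Fin n → ℕ
  weight Y P v = ∣ lookup P v ∣ + 3 * (D ∸ ∣ lookup Y v ∣)

  -- The answer `true` means that no admissible graph agrees with the state, so running out of fuel
  -- may safely answer `false`. Each unit of fuel pays for one new edge, and a 4-regular graph on 17
  -- vertices has only 34, so the fuel 100 in `Refuted` is ample.
  search expand : ℕ → Matrix n → Matrix n → ℕ → Bool
  prune         : ℕ → Matrix n → Matrix n → ℕ → Matrix n → Bool
  choose        : ℕ → Matrix n → Matrix n → ℕ → Matrix n → List (Fin n) → Bool
  complete      : ℕ → Matrix n → Matrix n → ℕ → Matrix n → Fin n → Bool
  branch        : ℕ → Matrix n → Matrix n → ℕ → Fin n → List (Fin n) → Bool
  fresh         : ℕ → Matrix n → Matrix n → ℕ → Fin n → Bool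

  search zero       Y X k = false
  search (suc fuel) Y X k = expand fuel Y X k
  expand fuel Y X k = prune fuel Y X k (possible Y X)
  prune fuel Y X k P = refuted P ∨ choose fuel Y X k P (unsaturated Y k)
  -- Every labelled vertex already has its D neighbours, so there is nothing to branch on and the
  -- state stays unrefuted.
  choose fuel Y X k P []       = false
  choose fuel Y X k P (u ∷ us) = complete fuel Y X k P (argmin (weight Y P) u (u ∷ us))
  complete fuel Y X k P v = branch fuel Y X k v (candidates (lookup Y v) (lookup P v) k)
  branch fuel Y X k v []       = fresh fuel Y X k v
  -- Later alternatives record that `w` was rejected, which makes the cases disjoint.
  branch fuel Y X k v (w ∷ ws) = search fuel (mark v w Y) X k ∧ branch fuel Y (mark v w X) k v ws
  fresh fuel Y X k v with k <? n
  ... | yes k<n = search fuel (mark v (fromℕ< k<n) Y) X (suc k)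
  -- All n labels are in use, so the neighbour that `v` still lacks cannot exist.
  ... | no  _   = true

  -- Soundness of the search

  record Agrees (G : Graph n D) (Y X : Matrix n) (k : ℕ) : Set where
    open Graph G
    field
      edge       : ∀ {u v} → entry Y u v → u ~ v
      nonEdge    : ∀ {u v} → entry X u v → ¬ u ~ v
      Y-sym      : ∀ {u v} → entry Y u v → entry Y v u
      Y-labelled : ∀ {u v} → entry Y u v → toℕ u < k
      -- The diagonal mentions labels from `k` on as well, but it survives any relabelling because
      -- no vertex is adjacent to itself.
      X-labelled : ∀ {u v} → entry X u v → u ≡ v ⊎ (toℕ u < k × toℕ v < k)

  module _ {G : Graph n D} {Y X k} (agrees : Agrees G Y X k) where
    open Graph G
    open Agrees agrees

    agrees-edge : ∀ {u v} → toℕ u < k → toℕ v < k → u ~ v → Agrees G (mark u v Y) X k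
    agrees-edge {u} {v} u<k v<k u~v = record
      { edge       = λ h → case-edge (mark⁻ {M = Y} h)
      ; nonEdge    = nonEdge
      ; Y-sym      = λ {a} {b} → mark-symmetric u v {Y} Y-sym {a} {b}
      ; Y-labelled = λ h → case-label (mark⁻ {M = Y} h)
      ; X-labelled = X-labelled
      }
      where
      case-edge : ∀ {a b} → (a ≡ u × b ≡ v) ⊎ (a ≡ v × b ≡ u) ⊎ entry Y a b → a ~ b
      case-edge (inj₁ (refl , refl))        = u~v
      case-edge (inj₂ (inj₁ (refl , refl))) = ~-sym u~v
      case-edge (inj₂ (inj₂ h))             = edge h

      case-label : ∀ {a b} → (a ≡ u × b ≡ v) ⊎ (a ≡ v × b ≡ u) ⊎ entry Y a b → toℕ a < k
      case-label (inj₁ (refl , refl))        = u<k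
      case-label (inj₂ (inj₁ (refl , refl))) = v<k
      case-label (inj₂ (inj₂ h))             = Y-labelled h

    agrees-nonEdge : ∀ {u v} → toℕ u < k → toℕ v < k → ¬ u ~ v → Agrees G Y (mark u v X) k
    agrees-nonEdge {u} {v} u<k v<k u≁v = record
      { edge       = edge
      ; nonEdge    = λ h → case-nonEdge (mark⁻ {M = X} h)
      ; Y-sym      = Y-sym
      ; Y-labelled = Y-labelled
      ; X-labelled = λ h → case-label (mark⁻ {M = X} h)
      }
      where
      case-nonEdge : ∀ {a b} → (a ≡ u × b ≡ v) ⊎ (a ≡ v × b ≡ u) ⊎ entry X a b → ¬ a ~ b
      case-nonEdge (inj₁ (refl , refl))        = u≁v
      case-nonEdge (inj₂ (inj₁ (refl , refl))) = u≁v ∘ ~-sym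
      case-nonEdge (inj₂ (inj₂ h))             = nonEdge h

      case-label : ∀ {a b} → (a ≡ u × b ≡ v) ⊎ (a ≡ v × b ≡ u) ⊎ entry X a b → a ≡ b ⊎ (toℕ a < k × toℕ b < k)
      case-label (inj₁ (refl , refl))        = inj₂ (u<k , v<k)
      case-label (inj₂ (inj₁ (refl , refl))) = inj₂ (v<k , u<k)
      case-label (inj₂ (inj₂ h))             = X-labelled h

    agrees-suc : Agrees G Y X (suc k)
    agrees-suc = record
      { edge       = edge
      ; nonEdge    = nonEdge
      ; Y-sym      = Y-sym
      ; Y-labelled = ℕ.m<n⇒m<1+n ∘ Y-labelled
      ; X-labelled = ⊎-map (λ e → e) (λ (p , q) → ℕ.m<n⇒m<1+n p , ℕ.m<n⇒m<1+n q) ∘ X-labelled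
      }

    agrees-relabel : (π : Permutation n n) → (∀ {u} → toℕ u < k → π ⟨$⟩ʳ u ≡ u) → Agrees (relabel π G) Y X k
    agrees-relabel π fixes = record
      { edge       = λ h → subst₂ _~_ (sym (fixes (Y-labelled h))) (sym (fixes (Y-labelled (Y-sym h)))) (edge h)
      ; nonEdge    = λ h → nonEdge′ h (X-labelled h)
      ; Y-sym      = Y-sym
      ; Y-labelled = Y-labelled
      ; X-labelled = X-labelled
      }
      where
      nonEdge′ : ∀ {u v} → entry X u v → u ≡ v ⊎ (toℕ u < k × toℕ v < k) → ¬ π ⟨$⟩ʳ u ~ π ⟨$⟩ʳ v
      nonEdge′ h (inj₁ refl)        = ~-irrefl
      nonEdge′ h (inj₂ (u<k , v<k)) = nonEdge h ∘ subst₂ _~_ (fixes u<k) (fixes v<k)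

    entry? : ∀ u v → entry Y u v ⊎ ¬ entry Y u v
    entry? u v with T? (lookup (lookup Y u) v)
    ... | yes h = inj₁ h
    ... | no  h = inj₂ h

    private
      W₂ W₃ : Matrix n
      W₂ = map (λ y → ⋃ y Y) Y
      W₃ = map (λ y → ⋃ y W₂) Y

      F R : Row n
      F = map (λ y → D ≤ᵇ ∣ y ∣) Y
      R = zipWith meets Y W₂

      walk₂ : ∀ {u w} → entry W₂ u w → ∃ λ v → entry Y u v × entry Y v w
      walk₂ {u} {w} h = ⋃⁻ (lookup Y u) Y w (subst (_∋ w) (lookup-map u (λ y → ⋃ y Y) Y) h)

      walk₃ : ∀ {u w} → entry W₃ u w → ∃₂ λ v x → entry Y u v × entry Y v x × entry Y x w
      walk₃ {u} {w} h with ⋃⁻ (lookup Y u) W₂ w (subst (_∋ w) (lookup-map u (λ y → ⋃ y W₂) Y) h)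
      ... | v , uv , vw with walk₂ vw
      ...   | x , vx , xw = v , x , uv , vx , xw

      full : ∀ {u v} → F ∋ u → u ~ v → entry Y u v
      full {u} {v} h u~v with entry? u v
      ... | inj₁ e = e
      ... | inj₂ e = contradiction (ℕ.≤-trans (≤ᵇ⇒≤ D _ (subst T (lookup-map u (λ y → D ≤ᵇ ∣ y ∣) Y) h)) ℕ.≤-refl)
                       (ℕ.<⇒≱ (subst (∣ lookup Y u ∣ <_) (regular u) (∣∣<size (adj u) (lookup Y u) (λ _ → edge) v u~v e)))

      known-triangle : ∀ {u} → R ∋ u → ∃₂ λ v w → entry Y u v × entry Y u w × entry Y v w
      known-triangle {u} h with meets⁻ (lookup Y u) (lookup W₂ u) (subst T (lookup-zipWith meets u Y W₂) h)
      ... | w , uw , uw₂ with walk₂ uw₂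
      ...   | v , uv , vw = v , w , uv , uw , vw

    private
      -- The edge would close the walk u, v, x, w to a square. A degenerate walk, with x = u or v =
      -- w, contains the edge uw itself, which is not yet known.
      not-walk₃ : ∀ {u w} → u ~ w → ¬ entry Y u w → ¬ entry W₃ u w
      not-walk₃ {u} {w} u~w uw∉ h with walk₃ h
      ... | v , x , uv , vx , xw = noSquare {u} {x} {v} {w}
              (λ { refl → uw∉ xw }) (λ { refl → uw∉ uv }) (edge uv) u~w (~-sym (edge vx)) (edge xw)

      module _ (uniq : Single) {u w} (u~w : u ~ w) (uw∉ : ¬ entry Y u w) where
        -- The new edge would put `u` into a triangle with `w`. If `u` already has a known triangle,
        -- uniqueness makes `w` one of its vertices, so the edge would be known. The same argument
        -- applies to `w` and, with both ends of the new edge, to a common neighbour.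
        first-endpoint : entry W₂ u w → ¬ R ∋ u
        first-endpoint uw₂ r with walk₂ uw₂ | known-triangle r
        ... | c , uc , cw | a , b , ua , ub , ab
          with uniq (edge ua , edge ub , edge ab) (u~w , edge uc , ~-sym (edge cw))
        ...   | inj₁ refl = uw∉ ua
        ...   | inj₂ refl = uw∉ ub

        second-endpoint : entry W₂ u w → ¬ R ∋ w
        second-endpoint uw₂ r with walk₂ uw₂ | known-triangle r
        ... | c , uc , cw | a , b , wa , wb , ab
          with uniq (edge wa , edge wb , edge ab) (~-sym u~w , ~-sym (edge cw) , edge uc)
        ...   | inj₁ refl = uw∉ (Y-sym wa)
        ...   | inj₂ refl = uw∉ (Y-sym wb)

        apex : ∀ {c} → entry Y u c → entry Y c w → ¬ R ∋ c
        apex uc cw r with known-triangle r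
        ... | a , b , ca , cb , ab
          with uniq (edge ca , edge cb , edge ab) (edge (Y-sym uc) , edge cw , u~w)
             | uniq (edge ca , edge cb , edge ab) (edge cw , edge (Y-sym uc) , ~-sym u~w)
        ...   | inj₁ refl | inj₁ refl = ~-irrefl u~w
        ...   | inj₁ refl | inj₂ refl = uw∉ ab
        ...   | inj₂ refl | inj₁ refl = uw∉ (Y-sym ab)
        ...   | inj₂ refl | inj₂ refl = ~-irrefl u~w

        not-secondTriangle : ¬ secondTriangle Y W₂ R u ∋ w
        not-secondTriangle h with lookup R u | first-endpoint
        ... | true  | first = first h tt
        ... | false | _ with ∪⁻ (lookup W₂ u ∩ R) _ w h
        ...   | inj₁ p = let uw₂ , r = ∩⁻ (lookup W₂ u) R w p in second-endpoint uw₂ r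
        ...   | inj₂ p with ⋃⁻ (lookup Y u ∩ R) Y w p
        ...     | c , uc∩ , cw = let uc , r = ∩⁻ (lookup Y u) R c uc∩ in apex uc cw r

    module _ (isSingle : T single → Single) where
      private
        not-forbidden : ∀ {u w} → u ~ w → ¬ entry Y u w → ¬ forbidden Y X W₂ W₃ F R u ∋ w
        not-forbidden {u} {w} u~w uw∉ h =
          [ (λ p → nonEdge p u~w)
          , [ not-walk₃ u~w uw∉
            , [ (λ p → uw∉ (Y-sym (full p (~-sym u~w)))) , excluded ]′ ∘ ∪⁻ F _ w
            ]′ ∘ ∪⁻ (lookup W₃ u) _ w
          ]′ (∪⁻ (lookup X u) _ w h)
          where
          excluded : ¬ guard single (secondTriangle Y W₂ R u) ∋ w
          excluded p = let s , q = guard⁻ single (secondTriangle Y W₂ R u) w p in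
            not-secondTriangle (isSingle s) u~w uw∉ q

      -- The exclusion rules are valid for edges not yet recorded. They may also strike recorded
      -- ones, for instance through walks that turn back, which is why `options` adds the row of `Y`
      -- separately.
      possible⁺ : ∀ {u w} → u ~ w → entry (possible Y X) u w
      possible⁺ {u} {w} u~w = subst (_∋ w) (sym (lookup∘tabulate (options Y X W₂ W₃ F R) u)) allowed
        where
        allowed : options Y X W₂ W₃ F R u ∋ w
        allowed with lookup F u | full {u} {w}
        ... | true  | f = f tt u~w
        ... | false | _ with entry? u w
        ...   | inj₁ e = ∪⁺ˡ (lookup Y u) _ w e
        ...   | inj₂ e = ∪⁺ʳ (lookup Y u) _ w (∁⁺ (forbidden Y X W₂ W₃ F R u) w (not-forbidden u~w e))

  clash⁻ : ∀ (r : Row m) qs → T (clash r qs) →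
           ∃₂ λ x y → x ≢ y × r ∋ x × r ∋ y × 2 ≤ ∣ lookup qs x ∩ lookup qs y ∣
  clash⁻ []      []       ()
  clash⁻ (x ∷ r) (q ∷ qs) h with Equivalence.to T-∨ h
  ... | inj₂ p = let x , y , x≢y , rx , ry , c = clash⁻ r qs p in
    suc x , suc y , x≢y ∘ Fin.suc-injective , rx , ry , c
  ... | inj₁ p with Equivalence.to T-∧ p
  ...   | rx , p with any⁻ (zipWith (λ y q′ → y ∧ (2 ≤ᵇ ∣ q ∩ q′ ∣)) r qs) p
  ...     | y , p with Equivalence.to T-∧ (subst T (lookup-zipWith (λ y q′ → y ∧ (2 ≤ᵇ ∣ q ∩ q′ ∣)) y r qs) p)
  ...       | ry , c = zero , suc y , (λ ()) , rx , ry , ≤ᵇ⇒≤ 2 _ c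

  module _ (G : Graph n D) (triangulated : Graph.Triangulated G) {P : Matrix n}
           (P⁺ : ∀ {u w} → Graph._~_ G u w → entry P u w) where
    open Graph G

    private
      Q = apart P

      apart⁻ : ∀ {u v} → entry Q u v → Far u v
      -- A vertex is not apart from itself: lying in a triangle, it has a neighbour, in which its
      -- row meets itself.
      apart⁻ {u} {v} h = (λ { refl → let a , _ , ua , _ = triangulated u in common a ua ua }) , common
        where
        disjoint : ¬ T (meets (lookup P u) (lookup P v))
        disjoint = T-not⁻ (subst T (lookup-map v (λ q → not (meets (lookup P u) q)) P)
                     (subst (_∋ v) (lookup-map u (λ p → map (λ q → not (meets p q)) P) P) h))

        common : ∀ c → u ~ c → v ~ c → ⊥
        common c uc vc = disjoint (meets⁺ (lookup P u) (lookup P v) c (P⁺ uc) (P⁺ vc))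

    refuted⁻ : ¬ T (refuted P)
    refuted⁻ h with Equivalence.to T-∨ h
    ... | inj₁ p with any-map⁻ (λ p → not (D ≤ᵇ ∣ p ∣)) P p
    ...   | v , q = T-not⁻ q (≤⇒≤ᵇ (subst (_≤ ∣ lookup P v ∣) (regular v) (size≤∣∣ (adj v) (lookup P v) (λ _ → P⁺))))
    refuted⁻ h | inj₂ p with Equivalence.to T-∨ p
    ... | inj₁ q with any-map⁻ (λ p → not (any (p ∩ map (meets p) P))) P q
    ...   | v , q with triangulated v
    ...     | a , b , va , vb , ab =
              T-not⁻ q (any⁺ (lookup P v ∩ map (meets (lookup P v)) P) a (∩⁺ (lookup P v) (map (meets (lookup P v)) P) a (P⁺ va)
                (subst T (sym (lookup-map a (meets (lookup P v)) P)) (meets⁺ (lookup P v) (lookup P a) b (P⁺ vb) (P⁺ ab)))))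
    refuted⁻ h | inj₂ p | inj₂ q with any-map⁻ (λ q → clash q Q) Q q
    ... | v , c with clash⁻ (lookup Q v) Q c
    ...   | x , y , x≢y , vx , vy , two with two-members (lookup Q x ∩ lookup Q y) two
    ...     | a , b , a≢b , pa , pb with ∩⁻ (lookup Q x) (lookup Q y) a pa | ∩⁻ (lookup Q x) (lookup Q y) b pb
    ...       | xa , ya | xb , yb = noFarSquare x≢y a≢b (apart⁻ xa) (apart⁻ xb) (apart⁻ ya) (apart⁻ yb)

  record Admissible (G : Graph n D) : Set where
    open Graph G
    field
      triangulated : Triangulated
      isSingle     : T single → Single

  relabel-admissible : ∀ (π : Permutation n n) {G} → Admissible G → Admissible (relabel π G)
  relabel-admissible π {G} adm = record
    { triangulated = relabel-triangulated π G triangulated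
    ; isSingle     = λ s → relabel-single π G (isSingle s)
    }
    where open Admissible adm

  transpose-fixes : ∀ {i j u : Fin n} → u ≢ i → u ≢ j → transpose i j ⟨$⟩ʳ u ≡ u
  transpose-fixes {i} {j} {u} u≢i u≢j with u ≟ i
  ... | yes eq = contradiction eq u≢i
  ... | no _ with u ≟ j
  ...   | yes eq = contradiction eq u≢j
  ...   | no _   = refl

  transpose-source : ∀ (i j : Fin n) → transpose i j ⟨$⟩ʳ i ≡ j
  transpose-source i j with i ≟ i
  ... | yes _  = refl
  ... | no i≢i = contradiction refl i≢i

  search-sound : ∀ fuel {Y X k} → T (search fuel Y X k) → ∀ G → Admissible G → ¬ Agrees G Y X k
  -- The invariant is that a missing neighbour `x` of `v` is among the remaining candidates or still
  -- unlabelled. Once the candidates are exhausted it is unlabelled, and exchanging it with label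
  -- `k` leaves all labels in use fixed.
  branch-sound : ∀ fuel {Y X k v} ws → T (branch fuel Y X k v ws) → ∀ G → Admissible G → Agrees G Y X k →
                 toℕ v < k → All (λ w → toℕ w < k) ws →
                 ∀ {x} → Graph._~_ G v x → x ∈ ws ⊎ k ≤ toℕ x → ⊥

  search-sound (suc fuel) {Y} {X} {k} h G adm agrees with Equivalence.to (T-∨ {refuted (possible Y X)}) h
  ... | inj₁ p = refuted⁻ G (Admissible.triangulated adm) {possible Y X} (possible⁺ agrees (Admissible.isSingle adm)) p
  ... | inj₂ p = chosen (unsaturated Y k) (all-filter (T? ∘ λ v → (toℕ v <ᵇ k) ∧ (∣ lookup Y v ∣ <ᵇ D)) (allFin n)) p
    where
    open Graph G
    open Agrees agrees
    P = possible Y X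

    completed : ∀ v → T ((toℕ v <ᵇ k) ∧ (∣ lookup Y v ∣ <ᵇ D)) → ¬ T (complete fuel Y X k P v)
    completed v c h with Equivalence.to T-∧ c
    ... | v<k , y<D with ∣∣<size⇒missing (adj v) (lookup Y v)
                          (subst (∣ lookup Y v ∣ <_) (sym (regular v)) (<ᵇ⇒< _ D y<D))
    ...   | x , vx , x∉ = branch-sound fuel (candidates (lookup Y v) (lookup P v) k) h G adm agrees (<ᵇ⇒< _ k v<k)
              (All.map (λ p → <ᵇ⇒< _ k (proj₁ (Equivalence.to T-∧ p))) (all-filter (T? ∘ isCandidate) (allFin n)))
              vx position
      where
      isCandidate : Fin n → Bool
      isCandidate w = (toℕ w <ᵇ k) ∧ lookup (lookup P v ∩ ∁ (lookup Y v)) w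

      position : x ∈ candidates (lookup Y v) (lookup P v) k ⊎ k ≤ toℕ x
      position with toℕ x <? k
      ... | no x≮k  = inj₂ (ℕ.≮⇒≥ x≮k)
      ... | yes x<k = inj₁ (∈-filter⁺ (T? ∘ isCandidate) (∈-allFin x)
              (Equivalence.from T-∧ (<⇒<ᵇ x<k , ∩⁺ (lookup P v) _ x (possible⁺ agrees (Admissible.isSingle adm) vx) (∁⁺ (lookup Y v) x x∉))))

    chosen : ∀ us → All (λ v → T ((toℕ v <ᵇ k) ∧ (∣ lookup Y v ∣ <ᵇ D))) us → ¬ T (choose fuel Y X k P us)
    chosen (u ∷ us) (c ∷ cs) = completed _ (argmin-all (weight Y P) c (c ∷ cs))

  branch-sound fuel {Y} {X} {k} {v} [] h G adm agrees v<k [] {x} vx (inj₂ k≤x) with k <? n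
  ... | no k≮n = k≮n (ℕ.≤-<-trans k≤x (Fin.toℕ<n x))
  ... | yes k<n = search-sound fuel h (relabel π G) (relabel-admissible π adm)
          (agrees-edge (agrees-suc (agrees-relabel agrees π fixes)) (ℕ.m<n⇒m<1+n v<k)
            (subst (_< suc k) (sym (Fin.toℕ-fromℕ< k<n)) (ℕ.n<1+n k))
            (subst₂ (Graph._~_ G) (sym (fixes v<k)) (sym (transpose-source (fromℕ< k<n) x)) vx))
    where
    π = transpose (fromℕ< k<n) x
    fixes : ∀ {u} → toℕ u < k → π ⟨$⟩ʳ u ≡ u
    fixes u<k = transpose-fixes
      (λ { refl → ℕ.<-irrefl (Fin.toℕ-fromℕ< k<n) u<k })
      (λ { refl → ℕ.<⇒≱ u<k k≤x })
  branch-sound fuel {Y} {X} {k} {v} (w ∷ ws) h G adm agrees v<k (w<k ∷ ws<k) {x} vx pos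
    with Equivalence.to (T-∧ {search fuel (mark v w Y) X k}) h
  ... | p , q with T? (Graph.adj G v w)
  ...   | yes vw = search-sound fuel p G adm (agrees-edge agrees v<k w<k vw)
  ...   | no ¬vw = branch-sound fuel ws q G adm (agrees-nonEdge agrees v<k w<k ¬vw) v<k ws<k vx (rest pos)
    where
    rest : x ∈ w ∷ ws ⊎ k ≤ toℕ x → x ∈ ws ⊎ k ≤ toℕ x
    rest (inj₁ (here refl)) = contradiction vx ¬vw
    rest (inj₁ (there x∈))  = inj₁ x∈
    rest (inj₂ k≤x)         = inj₂ k≤x

-- Placing a given pattern on the first labels

-- The first value is removed by `punchOut` and the remaining injection is extended on the
-- complement. For m < n this moves the vertices of a pattern to the first labels; for m = n it
-- turns an injection into a permutation.
extend : (f : Fin m → Fin n) → Injective _≡_ _≡_ f → (m≤n : m ≤ n) →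
         Σ (Permutation n n) λ π → ∀ i → π ⟨$⟩ʳ inject≤ i m≤n ≡ f i
extend {zero}          f inj m≤n       = Perm.id , λ ()
extend {suc m} {suc n} f inj (s≤s m≤n) = insert zero (f zero) π , agrees
  where
  f₀≢ : ∀ i → f zero ≢ f (suc i)
  f₀≢ i eq with inj eq
  ... | ()

  rest : Σ (Permutation n n) λ π → ∀ i → π ⟨$⟩ʳ inject≤ i m≤n ≡ punchOut (f₀≢ i)
  rest = extend (λ i → punchOut (f₀≢ i))
           (λ {i} {j} eq → Fin.suc-injective (inj (Fin.punchOut-injective (f₀≢ i) (f₀≢ j) eq))) m≤n

  π = proj₁ rest

  agrees : ∀ i → insert zero (f zero) π ⟨$⟩ʳ inject≤ i (s≤s m≤n) ≡ f i
  agrees zero    = refl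
  agrees (suc i) = trans (insert-punchIn zero (f zero) π (inject≤ i m≤n))
    (trans (cong (punchIn (f zero)) (proj₂ rest i)) (Fin.punchIn-punchOut (f₀≢ i)))

initial : m ≤ n → List (Fin m × Fin m) → Matrix n
initial m≤n = foldr (λ (i , j) → mark (inject≤ i m≤n) (inject≤ j m≤n)) (none _)

-- A record rather than an equation, so that comparing two such types never
-- runs the search.
record Refuted (D : ℕ) (single : Bool) {m n : ℕ} (m≤n : m ≤ n) (es : List (Fin m × Fin m)) : Set where
  field found : Search.search D single 100 (initial m≤n es) (identity n) m ≡ true

module _ {n D : ℕ} (single : Bool) (m≤n : m ≤ n) where
  open Search {n} D single

  pattern-absent : ∀ es → Refuted D single m≤n es →
                   (G : Graph n D) → Admissible G → (vs : Vec (Fin n) m) → Unique vs →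
                   ¬ All (λ (i , j) → Graph._~_ G (lookup vs i) (lookup vs j)) es
  pattern-absent es refuted G adm vs unique embedded =
    search-sound 100 (Equivalence.from T-≡ (Refuted.found refuted)) G′ (relabel-admissible π adm) (agrees embedded)
    where
    open Graph G using (_~_)

    placed : Σ (Permutation n n) λ π → ∀ i → π ⟨$⟩ʳ inject≤ i m≤n ≡ lookup vs i
    placed = extend (lookup vs) (λ {i} {j} → lookup-injective unique i j) m≤n

    π  = proj₁ placed
    G′ = relabel π G

    label : ∀ i → toℕ (inject≤ i m≤n) < m
    label i = subst (_< m) (sym (Fin.toℕ-inject≤ i m≤n)) (Fin.toℕ<n i)

    agrees : ∀ {es} → All (λ (i , j) → lookup vs i ~ lookup vs j) es → Agrees G′ (initial m≤n es) (identity n) m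
    agrees [] = record
      { edge       = λ {u} {v} h → ⊥-elim (none⁻ u v h)
      ; nonEdge    = λ h → subst (λ v → ¬ _ ~ π ⟨$⟩ʳ v) (identity⁻ h) (Graph.~-irrefl G)
      ; Y-sym      = λ {u} {v} h → ⊥-elim (none⁻ u v h)
      ; Y-labelled = λ {u} {v} h → ⊥-elim (none⁻ u v h)
      ; X-labelled = λ h → inj₁ (identity⁻ h)
      }
    agrees {(i , j) ∷ es} (e ∷ embedded) =
      agrees-edge (agrees embedded) (label i) (label j) (subst₂ _~_ (sym (proj₂ placed i)) (sym (proj₂ placed j)) e)

-- Some vertex lies in no triangle when κ ≤ 4

not-triangulated : ∀ {n D} → Refuted D false {1} {suc n} (s≤s z≤n) [] → (G : Graph (suc n) D) → ¬ Graph.Triangulated G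
not-triangulated refuted G tri =
  pattern-absent false (s≤s z≤n) [] refuted G (record { triangulated = tri ; isSingle = λ () }) (zero ∷ []) ([] ∷ []) []

bowtie : List (Fin 5 × Fin 5)
bowtie = (0F , 1F) ∷ (0F , 2F) ∷ (0F , 3F) ∷ (0F , 4F) ∷ (1F , 2F) ∷ (3F , 4F) ∷ []

triangle : List (Fin 3 × Fin 3)
triangle = (0F , 1F) ∷ (0F , 2F) ∷ (1F , 2F) ∷ []

bowtie-refuted : Refuted 4 false (ℕ.m≤m+n 5 12) bowtie
bowtie-refuted = record { found = refl }

triangle-refuted : Refuted 4 true (ℕ.m≤m+n 3 14) triangle
triangle-refuted = record { found = refl }

module _ (G : Graph 17 4) (tri : Graph.Triangulated G) where
  open Graph G

  private
    ~⇒≢ : ∀ {u v} → u ~ v → u ≢ v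
    ~⇒≢ u~v refl = ~-irrefl u~v

  -- Without squares an edge lies in at most one triangle, so two triangles at `v` that differ in
  -- `c` share no vertex but `v`. They span five distinct vertices and form the excluded bowtie.
  single₁₇ : Single
  single₁₇ {v} {a} {b} {c} {d} (v~a , v~b , a~b) (v~c , v~d , c~d) with c ≟ a | c ≟ b
  ... | yes c≡a | _       = inj₁ c≡a
  ... | no _    | yes c≡b = inj₂ c≡b
  ... | no c≢a  | no c≢b  = ⊥-elim (pattern-absent false (ℕ.m≤m+n 5 12) bowtie bowtie-refuted
      G (record { triangulated = tri ; isSingle = λ () })
      (v ∷ a ∷ b ∷ c ∷ d ∷ [])
      ( (~⇒≢ v~a ∷ ~⇒≢ v~b ∷ ~⇒≢ v~c ∷ ~⇒≢ v~d ∷ [])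
      ∷ (~⇒≢ a~b ∷ ≢-sym c≢a ∷ ≢-sym d≢a ∷ [])
      ∷ (≢-sym c≢b ∷ ≢-sym d≢b ∷ [])
      ∷ (~⇒≢ c~d ∷ []) ∷ [] ∷ [])
      (v~a ∷ v~b ∷ v~c ∷ v~d ∷ a~b ∷ c~d ∷ []))
    where
    d≢a : d ≢ a
    d≢a refl = noSquare (~⇒≢ v~a) (≢-sym c≢b) v~b v~c a~b (~-sym c~d)

    d≢b : d ≢ b
    d≢b refl = noSquare (~⇒≢ v~b) (≢-sym c≢a) v~a v~c (~-sym a~b) (~-sym c~d)

  not-triangulated₁₇ : ⊥
  not-triangulated₁₇ with tri 0F
  ... | a , b , v~a , v~b , a~b = pattern-absent true (ℕ.m≤m+n 3 14) triangle triangle-refuted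
      G (record { triangulated = tri ; isSingle = λ _ → single₁₇ })
      (0F ∷ a ∷ b ∷ [])
      ((~⇒≢ v~a ∷ ~⇒≢ v~b ∷ []) ∷ (~⇒≢ a~b ∷ []) ∷ [] ∷ [])
      (v~a ∷ v~b ∷ a~b ∷ [])

triangle-free-vertex : ∀ k → k ≤ 3 → (G : Graph (suc (suc k * suc k)) (suc k)) →
                       ∃ λ v → ∀ a b → ¬ Graph.Triangle G v a b
triangle-free-vertex k k≤3 G with Fin.any? (λ v → ¬? (Fin.any? (λ a → Fin.any? (λ b → Graph.triangle? G v a b))))
... | yes (v , free) = v , λ a b t → free (a , b , t)
... | no  all        = ⊥-elim (refute k k≤3 G λ v →
        decidable-stable (Fin.any? λ a → Fin.any? λ b → Graph.triangle? G v a b) λ ¬t → all (v , ¬t))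
  where
  refute : ∀ k → k ≤ 3 → (G : Graph (suc (suc k * suc k)) (suc k)) → ¬ Graph.Triangulated G
  refute 0 _ = not-triangulated (record { found = refl })
  refute 1 _ = not-triangulated (record { found = refl })
  refute 2 _ = not-triangulated (record { found = refl })
  refute 3 _ = not-triangulated₁₇
  refute (suc (suc (suc (suc k)))) (s≤s (s≤s (s≤s ())))

-- The map Θ

∑≡sum : ∀ n (f : Fin n → ℤ) → ∑ n f ≡ ℤSum.sum f
∑≡sum zero    f = refl
∑≡sum (suc n) f = cong (ℤ._+_ (f zero)) (∑≡sum n (f ∘ suc))

∑-cong : ∀ {n} {f g : Fin n → ℤ} → (∀ i → f i ≡ g i) → ∑ n f ≡ ∑ n g
∑-cong {zero}  h = refl
∑-cong {suc n} h = cong₂ ℤ._+_ (h zero) (∑-cong (h ∘ suc))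

∑-+ : ∀ {n} (f g : Fin n → ℤ) → ∑ n (λ i → f i ℤ.+ g i) ≡ ∑ n f ℤ.+ ∑ n g
∑-+ {n} f g = trans (∑≡sum n _) (trans (ℤSum.∑-distrib-+ f g) (sym (cong₂ ℤ._+_ (∑≡sum n f) (∑≡sum n g))))

∑-*ˡ : ∀ {n} c (f : Fin n → ℤ) → ∑ n (λ i → c ℤ.* f i) ≡ c ℤ.* ∑ n f
∑-*ˡ {n} c f = trans (∑≡sum n _) (trans (sym (ℤSum.*-distribˡ-sum c f)) (cong (ℤ._*_ c) (sym (∑≡sum n f))))

∑-swap : ∀ {m n} (f : Fin m → Fin n → ℤ) → ∑ m (λ i → ∑ n (f i)) ≡ ∑ n (λ j → ∑ m (λ i → f i j))
∑-swap {m} {n} f = trans (∑∑≡sum f) (trans (ℤSum.∑-comm f) (sym (∑∑≡sum (λ j i → f i j))))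
  where
  ∑∑≡sum : ∀ {m n} (f : Fin m → Fin n → ℤ) → ∑ m (λ i → ∑ n (f i)) ≡ ℤSum.sum (λ i → ℤSum.sum (f i))
  ∑∑≡sum {m} {n} f = trans (∑-cong (λ i → ∑≡sum n (f i))) (∑≡sum m _)

∑-permute : ∀ {m n} (f : Fin n → ℤ) (π : Permutation m n) → ∑ m (λ i → f (π ⟨$⟩ʳ i)) ≡ ∑ n f
∑-permute {m} {n} f π = trans (∑≡sum m _) (trans (sym (ℤSum.sum-permute f π)) (sym (∑≡sum n f)))

∑-neg : ∀ {n} (f : Fin n → ℤ) → ∑ n (λ i → ℤ.- f i) ≡ ℤ.- ∑ n f
∑-neg {zero}  f = refl
∑-neg {suc n} f = trans (cong (ℤ._+_ (ℤ.- f zero)) (∑-neg (f ∘ suc))) (sym (ℤ.neg-distrib-+ (f zero) _))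

∑-minus : ∀ {n} (f g : Fin n → ℤ) → ∑ n (λ i → f i ℤ.- g i) ≡ ∑ n f ℤ.- ∑ n g
∑-minus {n} f g = trans (∑-+ f (λ i → ℤ.- g i)) (cong (ℤ._+_ (∑ n f)) (∑-neg g))

∑-0 : ∀ n → ∑ n (λ _ → 0ℤ) ≡ 0ℤ
∑-0 zero    = refl
∑-0 (suc n) = trans (ℤ.+-identityˡ _) (∑-0 n)

∑-1 : ∀ n → ∑ n (λ _ → 1ℤ) ≡ + n
∑-1 zero    = refl
∑-1 (suc n) = cong (ℤ._+_ 1ℤ) (∑-1 n)

δ-refl : ∀ {n} (i : Fin n) → δ i i ≡ 1ℤ
δ-refl i with i ≟ i
... | yes _  = refl
... | no i≢i = contradiction refl i≢i

δ-≢ : ∀ {n} {i j : Fin n} → i ≢ j → δ i j ≡ 0ℤ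
δ-≢ {i = i} {j} i≢j with i ≟ j
... | yes eq = contradiction eq i≢j
... | no _   = refl

δ-injective : ∀ {m n} (f : Fin m → Fin n) → Injective _≡_ _≡_ f → ∀ i j → δ (f i) (f j) ≡ δ i j
δ-injective f inj i j with i ≟ j
... | yes refl = δ-refl (f i)
... | no i≢j   = δ-≢ (i≢j ∘ inj)

δ-sym : ∀ {n} (i j : Fin n) → δ i j ≡ δ j i
δ-sym i j with i ≟ j
... | yes refl = sym (δ-refl i)
... | no i≢j   = sym (δ-≢ (≢-sym i≢j))

∑-δ : ∀ {n} (i : Fin n) → ∑ n (δ i) ≡ 1ℤ
∑-δ {suc n} zero    = trans (cong (ℤ._+_ 1ℤ) (trans (∑-cong {n} (λ j → δ-≢ {i = zero} {suc j} λ ())) (∑-0 n))) refl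
∑-δ {suc n} (suc i) = trans (cong₂ ℤ._+_ (δ-≢ {i = suc i} {zero} λ ()) (trans (∑-cong (δ-injective suc Fin.suc-injective i)) (∑-δ i))) refl

∑-mono : ∀ {n} {f g : Fin n → ℤ} → (∀ i → f i ℤ.≤ g i) → ∑ n f ℤ.≤ ∑ n g
∑-mono {zero}  h = ℤ.≤-refl
∑-mono {suc n} h = ℤ.+-mono-≤ (h zero) (∑-mono (h ∘ suc))

01⇒0≤ : ∀ {x} → Is01 x → 0ℤ ℤ.≤ x
01⇒0≤ (inj₁ refl) = ℤ.+≤+ z≤n
01⇒0≤ (inj₂ refl) = ℤ.+≤+ z≤n

term≤∑ : ∀ {n} (f : Fin n → ℤ) → (∀ i → 0ℤ ℤ.≤ f i) → ∀ i → f i ℤ.≤ ∑ n f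
term≤∑ {suc n} f h zero    = ℤ.≤-trans (ℤ.≤-reflexive (sym (ℤ.+-identityʳ (f zero))))
  (ℤ.+-monoʳ-≤ (f zero) (ℤ.≤-trans (ℤ.≤-reflexive (sym (∑-0 n))) (∑-mono (h ∘ suc))))
term≤∑ {suc n} f h (suc i) = ℤ.≤-trans (ℤ.≤-reflexive (sym (ℤ.+-identityˡ (f (suc i)))))
  (ℤ.+-mono-≤ (h zero) (term≤∑ (f ∘ suc) (h ∘ suc) i))

two-terms : ∀ {n} (f : Fin n → ℤ) → (∀ i → 0ℤ ℤ.≤ f i) → ∀ {x y} → x ≢ y → f x ≡ 1ℤ → f y ≡ 1ℤ → + 2 ℤ.≤ ∑ n f
two-terms {n} f f≥0 {x} {y} x≢y fx fy =
  subst (ℤ._≤ ∑ n f) (trans (∑-+ (δ x) (δ y)) (cong₂ ℤ._+_ (∑-δ x) (∑-δ y))) (∑-mono bound)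
  where
  bound : ∀ i → δ x i ℤ.+ δ y i ℤ.≤ f i
  bound i with x ≟ i | y ≟ i
  ... | yes refl | yes refl = contradiction refl x≢y
  ... | yes refl | no _     = ℤ.≤-reflexive (sym fx)
  ... | no _     | yes refl = ℤ.≤-reflexive (sym fy)
  ... | no _     | no _     = f≥0 i

0≤x²-x : ∀ x → 0ℤ ℤ.≤ x ℤ.* x ℤ.- x
0≤x²-x (+ zero)     = ℤ.≤-refl
0≤x²-x (+ suc n)    = subst (0ℤ ℤ.≤_) (trans (ℤ.pos-* (suc n) n) (factor (+ suc n))) (ℤ.+≤+ z≤n)
  where
  factor : ∀ x → x ℤ.* (x ℤ.- 1ℤ) ≡ x ℤ.* x ℤ.- x
  factor = solve-∀
0≤x²-x -[1+ n ]     = ℤ.+≤+ z≤n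

x²-x≤0⇒01 : ∀ x → x ℤ.* x ℤ.- x ℤ.≤ 0ℤ → Is01 x
x²-x≤0⇒01 (+ 0)           _ = inj₁ refl
x²-x≤0⇒01 (+ 1)           _ = inj₂ refl
x²-x≤0⇒01 (+ suc (suc n)) h with subst (ℤ._≤ 0ℤ) (factor (+ suc (suc n))) h
  where
  factor : ∀ x → x ℤ.* x ℤ.- x ≡ x ℤ.* (x ℤ.- 1ℤ)
  factor = solve-∀
... | ℤ.+≤+ ()
x²-x≤0⇒01 -[1+ n ]        (ℤ.+≤+ ())

01-square : ∀ {x} → Is01 x → x ℤ.* x ≡ x
01-square (inj₁ refl) = refl
01-square (inj₂ refl) = refl

01-product : ∀ {x y} → Is01 x → Is01 y → 0ℤ ℤ.≤ x ℤ.* y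
01-product (inj₁ refl) _           = ℤ.≤-refl
01-product (inj₂ refl) (inj₁ refl) = ℤ.≤-refl
01-product (inj₂ refl) (inj₂ refl) = ℤ.+≤+ z≤n

module _ (k : ℕ) where
  private
    κ : ℤ
    κ = + suc k

    r : ℕ
    r = suc k * suc k

  M : Set
  M = Mat (Fin (suc r))

  Binary : M → Set
  Binary X = ∀ i j → Is01 (X i j)

  RowRegular ColumnRegular : M → Set
  RowRegular X = ∀ i → ∑ (suc r) (X i) ≡ κ
  ColumnRegular X = ∀ j → ∑ (suc r) (λ i → X i j) ≡ κ

  _≈_ : M → M → Set
  X ≈ Y = ∀ i j → X i j ≡ Y i j

  gram : M → M
  gram X i j = ∑ (suc r) (λ l → X i l ℤ.* X j l)

  Θ-entry : ∀ X → RowRegular X → ∀ i j → Θ X i j ≡ ((κ ℤ.- 1ℤ) ℤ.* δ i j ℤ.+ 1ℤ) ℤ.- gram X i j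
  Θ-entry X rows i j = cong (λ c → ((c ℤ.- 1ℤ) ℤ.* δ i j ℤ.+ 1ℤ) ℤ.- gram X i j) (rows zero)

  Θ-off : ∀ X → RowRegular X → ∀ {i j} → i ≢ j → Θ X i j ≡ 1ℤ ℤ.- gram X i j
  Θ-off X rows {i} {j} i≢j = trans (Θ-entry X rows i j)
    (cong (λ d → (d ℤ.+ 1ℤ) ℤ.- gram X i j) (trans (cong (ℤ._*_ (κ ℤ.- 1ℤ)) (δ-≢ i≢j)) (ℤ.*-zeroʳ (κ ℤ.- 1ℤ))))

  Θ-diagonal : ∀ X → RowRegular X → ∀ i → Θ X i i ≡ κ ℤ.- gram X i i
  Θ-diagonal X rows i = trans (Θ-entry X rows i i)
    (trans (cong (λ d → ((κ ℤ.- 1ℤ) ℤ.* d ℤ.+ 1ℤ) ℤ.- gram X i i) (δ-refl i)) (simplify κ (gram X i i)))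
    where
    simplify : ∀ c g → ((c ℤ.- 1ℤ) ℤ.* 1ℤ ℤ.+ 1ℤ) ℤ.- g ≡ c ℤ.- g
    simplify = solve-∀

  Θ-sym : ∀ X i j → Θ X i j ≡ Θ X j i
  Θ-sym X i j = cong₂ (λ d g → ((∑ (suc r) (X zero) ℤ.- 1ℤ) ℤ.* d ℤ.+ 1ℤ) ℤ.- g) (δ-sym i j)
    (∑-cong (λ l → ℤ.*-comm (X i l) (X j l)))

  Θ-cong : ∀ {X Y} → X ≈ Y → Θ X ≈ Θ Y
  Θ-cong h i j = cong₂ (λ c g → ((c ℤ.- 1ℤ) ℤ.* δ i j ℤ.+ 1ℤ) ℤ.- g) (∑-cong (h zero))
    (∑-cong (λ l → cong₂ ℤ._*_ (h i l) (h j l)))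

  -- A row sums to (κ-1) + n - κ², which is κ again exactly because n = κ² + 1. Hence λ = κ for all
  -- iterates.
  Θ-rowRegular : ∀ X → RowRegular X → ColumnRegular X → RowRegular (Θ X)
  Θ-rowRegular X rows cols i = begin
    ∑ (suc r) (Θ X i)                                                              ≡⟨ ∑-cong (Θ-entry X rows i) ⟩
    ∑ (suc r) (λ j → ((κ ℤ.- 1ℤ) ℤ.* δ i j ℤ.+ 1ℤ) ℤ.- gram X i j)                 ≡⟨ ∑-minus (λ j → (κ ℤ.- 1ℤ) ℤ.* δ i j ℤ.+ 1ℤ) (gram X i) ⟩
    ∑ (suc r) (λ j → (κ ℤ.- 1ℤ) ℤ.* δ i j ℤ.+ 1ℤ) ℤ.- ∑ (suc r) (gram X i)         ≡⟨ cong₂ ℤ._-_ first second ⟩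
    ((κ ℤ.- 1ℤ) ℤ.* 1ℤ ℤ.+ (1ℤ ℤ.+ κ ℤ.* κ)) ℤ.- κ ℤ.* κ                           ≡⟨ simplify κ ⟩
    κ ∎
    where
    open ≡-Reasoning

    first : ∑ (suc r) (λ j → (κ ℤ.- 1ℤ) ℤ.* δ i j ℤ.+ 1ℤ) ≡ (κ ℤ.- 1ℤ) ℤ.* 1ℤ ℤ.+ (1ℤ ℤ.+ κ ℤ.* κ)
    first = trans (∑-+ (λ j → (κ ℤ.- 1ℤ) ℤ.* δ i j) (λ _ → 1ℤ))
      (cong₂ ℤ._+_ (trans (∑-*ˡ (κ ℤ.- 1ℤ) (δ i)) (cong (ℤ._*_ (κ ℤ.- 1ℤ)) (∑-δ i)))
                   (trans (∑-1 (suc r)) (cong (ℤ._+_ 1ℤ) (ℤ.pos-* (suc k) (suc k)))))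

    second : ∑ (suc r) (gram X i) ≡ κ ℤ.* κ
    second = begin
      ∑ (suc r) (λ j → ∑ (suc r) (λ l → X i l ℤ.* X j l)) ≡⟨ ∑-swap (λ j l → X i l ℤ.* X j l) ⟩
      ∑ (suc r) (λ l → ∑ (suc r) (λ j → X i l ℤ.* X j l)) ≡⟨ ∑-cong (λ l → ∑-*ˡ (X i l) (λ j → X j l)) ⟩
      ∑ (suc r) (λ l → X i l ℤ.* ∑ (suc r) (λ j → X j l)) ≡⟨ ∑-cong (λ l → trans (cong (ℤ._*_ (X i l)) (cols l)) (ℤ.*-comm (X i l) κ)) ⟩
      ∑ (suc r) (λ l → κ ℤ.* X i l)                       ≡⟨ ∑-*ˡ κ (X i) ⟩
      κ ℤ.* ∑ (suc r) (X i)                               ≡⟨ cong (ℤ._*_ κ) (rows i) ⟩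
      κ ℤ.* κ                                             ∎

    simplify : ∀ c → ((c ℤ.- 1ℤ) ℤ.* 1ℤ ℤ.+ (1ℤ ℤ.+ c ℤ.* c)) ℤ.- c ℤ.* c ≡ c
    simplify = solve-∀

  Θ-columnRegular : ∀ X → RowRegular X → ColumnRegular X → ColumnRegular (Θ X)
  Θ-columnRegular X rows cols j = trans (∑-cong (λ i → Θ-sym X i j)) (Θ-rowRegular X rows cols j)

  -- A non-negative diagonal of Θ X forces Σ (x² - x) ≤ 0 over each row of X,
  -- where every integer x satisfies x² - x ≥ 0.
  Θ-binary⁻ : ∀ X → RowRegular X → Binary (Θ X) → Binary X
  Θ-binary⁻ X rows bin i j = x²-x≤0⇒01 (X i j) (ℤ.≤-trans (term≤∑ excess (λ l → 0≤x²-x (X i l)) j) total)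
    where
    excess : Fin (suc r) → ℤ
    excess l = X i l ℤ.* X i l ℤ.- X i l

    total : ∑ (suc r) excess ℤ.≤ 0ℤ
    total = subst (ℤ._≤ 0ℤ)
      (trans (flip-sign κ (gram X i i))
        (sym (trans (∑-minus (λ l → X i l ℤ.* X i l) (X i)) (cong (ℤ._-_ (gram X i i)) (rows i)))))
      (ℤ.neg-mono-≤ (subst (0ℤ ℤ.≤_) (Θ-diagonal X rows i) (01⇒0≤ (bin i i))))
      where
      flip-sign : ∀ c g → ℤ.- (c ℤ.- g) ≡ g ℤ.- c
      flip-sign = solve-∀

  Θ-zero-diagonal : ∀ X → RowRegular X → Binary X → ∀ i → Θ X i i ≡ 0ℤ
  Θ-zero-diagonal X rows bin i = trans (Θ-diagonal X rows i)
    (trans (cong (ℤ._-_ κ) (trans (∑-cong (λ l → 01-square (bin i l))) (rows i))) (ℤ.+-inverseʳ κ))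

  -- Two common neighbours make the Gram entry at least 2, and the off-diagonal entry of `Θ X`, 1
  -- minus that, negative. It serves for `A` and again for `Θ A`.
  Θ-square-free : ∀ X → RowRegular X → Binary X → Binary (Θ X) → ∀ {u v x y} → u ≢ v → x ≢ y →
                  X u x ≡ 1ℤ → X u y ≡ 1ℤ → X v x ≡ 1ℤ → X v y ≡ 1ℤ → ⊥
  Θ-square-free X rows bin Θbin {u} {v} u≢v x≢y ux uy vx vy
    = 2≰1 (ℤ.≤-trans
        (two-terms (λ l → X u l ℤ.* X v l) (λ l → 01-product (bin u l) (bin v l)) x≢y (cong₂ ℤ._*_ ux vx) (cong₂ ℤ._*_ uy vy))
        (ℤ.0≤i-j⇒j≤i {1ℤ} (subst (0ℤ ℤ.≤_) (Θ-off X rows u≢v) (01⇒0≤ (Θbin u v)))))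
    where
    2≰1 : ¬ + 2 ℤ.≤ 1ℤ
    2≰1 (ℤ.+≤+ (s≤s ()))

  -- Periodic matrices and their graphs

  module _ (A : M) (rows : RowRegular A) (cols : ColumnRegular A) (bin : Binary A)
           {m : ℕ} (1≤m : 1 ≤ m) (periodic : Θ^ m A ≈ A) where

    Θ^-regular : ∀ j → RowRegular (Θ^ j A) × ColumnRegular (Θ^ j A)
    Θ^-regular zero    = rows , cols
    Θ^-regular (suc j) = let r , c = Θ^-regular j in Θ-rowRegular (Θ^ j A) r c , Θ-columnRegular (Θ^ j A) r c

    Θ^-double : ∀ a → Θ^ (a + m) A ≈ Θ^ a A
    Θ^-double zero    = periodic
    Θ^-double (suc a) = Θ-cong (Θ^-double a)

    Θ^-binary⁻ : ∀ i j → Binary (Θ^ (i + j) A) → Binary (Θ^ j A)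
    Θ^-binary⁻ zero    j b = b
    Θ^-binary⁻ (suc i) j b = Θ^-binary⁻ i j (Θ-binary⁻ _ (proj₁ (Θ^-regular (i + j))) b)

    -- Binarity descends from `Θ^ (m + m) A`, which is `A` again. Two periods rather than one make
    -- the exponent 2 available even for m = 1.
    binary-iterate : ∀ j → j ≤ m + m → Binary (Θ^ j A)
    binary-iterate j j≤2m = Θ^-binary⁻ (m + m ∸ j) j
      (subst (λ l → Binary (Θ^ l A)) (sym (ℕ.m∸n+n≡m j≤2m))
        (λ u v → subst Is01 (sym (trans (Θ^-double m u v) (periodic u v))) (bin u v)))

    Θ-binary : Binary (Θ A)
    Θ-binary = binary-iterate 1 (ℕ.≤-trans 1≤m (ℕ.m≤m+n m m))

    Θ²-binary : Binary (Θ (Θ A))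
    Θ²-binary = binary-iterate 2 (ℕ.+-mono-≤ 1≤m 1≤m)

    -- Every value of Θ is symmetric, and it has zero diagonal when its argument is binary. Being
    -- the image of its predecessor in the cycle, `A` inherits both.
    image : ∃ λ B → RowRegular B × Binary B × Θ B ≈ A
    image = last m 1≤m (ℕ.m≤m+n m m) periodic
      where
      last : ∀ j → 1 ≤ j → j ≤ m + m → Θ^ j A ≈ A → ∃ λ B → RowRegular B × Binary B × Θ B ≈ A
      last (suc j) _ j≤2m eq = Θ^ j A , proj₁ (Θ^-regular j) , binary-iterate j (ℕ.≤-trans (ℕ.n≤1+n j) j≤2m) , eq

    A-sym : ∀ i j → A i j ≡ A j i
    A-sym i j with image
    ... | B , _ , _ , eq = trans (sym (eq i j)) (trans (Θ-sym B i j) (eq j i))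

    A-diagonal : ∀ i → A i i ≡ 0ℤ
    A-diagonal i with image
    ... | B , rowsB , binB , eq = trans (sym (eq i i)) (Θ-zero-diagonal B rowsB binB i)

    one? : ∀ u v → Dec (A u v ≡ 1ℤ)
    one? u v = A u v ℤ.≟ 1ℤ

    adjacency : Fin (suc r) → Fin (suc r) → Bool
    adjacency u v = ⌊ one? u v ⌋

    private
      ∑≡size : ∀ {n} (f : Fin n → ℤ) → (∀ i → Is01 (f i)) → ∑ n f ≡ + size (λ i → ⌊ f i ℤ.≟ 1ℤ ⌋)
      ∑≡size {zero}  f b = refl
      ∑≡size {suc n} f b with f zero | b zero
      ... | _ | inj₁ refl = trans (ℤ.+-identityˡ _) (∑≡size (f ∘ suc) (b ∘ suc))
      ... | _ | inj₂ refl = cong (ℤ._+_ 1ℤ) (∑≡size (f ∘ suc) (b ∘ suc))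

      far-one : ∀ {u v} → u ≢ v → (∀ c → T (adjacency u c) → T (adjacency v c) → ⊥) → Θ A u v ≡ 1ℤ
      far-one {u} {v} u≢v disjoint = trans (Θ-off A rows u≢v) (cong (ℤ._-_ 1ℤ) (trans (∑-cong vanish) (∑-0 (suc r))))
        where
        vanish : ∀ l → A u l ℤ.* A v l ≡ 0ℤ
        vanish l with bin u l | bin v l
        ... | inj₁ ul | _       = cong (ℤ._* A v l) ul
        ... | inj₂ ul | inj₁ vl = trans (cong (ℤ._*_ (A u l)) vl) (ℤ.*-zeroʳ (A u l))
        ... | inj₂ ul | inj₂ vl = ⊥-elim (disjoint l (fromWitness ul) (fromWitness vl))

    graph : Graph (suc r) (suc k)
    graph = record
      { adj         = adjacency
      ; ~-sym       = λ {u} {v} h → fromWitness (trans (A-sym v u) (toWitness h))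
      ; ~-irrefl    = λ {v} h → 0≢1 (trans (sym (A-diagonal v)) (toWitness h))
      ; regular     = λ v → ℤ.+-injective (trans (sym (∑≡size (A v) (bin v))) (rows v))
      ; noSquare    = λ u≢v x≢y p q s t → Θ-square-free A rows bin Θ-binary u≢v x≢y
                        (toWitness p) (toWitness q) (toWitness s) (toWitness t)
      ; noFarSquare = λ u≢v x≢y (p≢ , p) (q≢ , q) (s≢ , s) (t≢ , t) →
                        Θ-square-free (Θ A) (proj₁ (Θ^-regular 1)) Θ-binary Θ²-binary u≢v x≢y
                          (far-one p≢ p) (far-one q≢ q) (far-one s≢ s) (far-one t≢ t)
      }
      where
      0≢1 : 0ℤ ≢ 1ℤ
      0≢1 ()

-- Standard forms

record Enumeration (p : Fin n → Bool) (d : ℕ) : Set where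
  field
    at           : Fin d → Fin n
    at-injective : Injective _≡_ _≡_ at
    at-∈         : ∀ i → T (p (at i))
    index        : ∀ j → T (p j) → Fin d
    at-index     : ∀ j pj → at (index j pj) ≡ j

enumerate : ∀ {n} (p : Fin n → Bool) → Enumeration p (size p)
enumerate {zero} p = record
  { at = λ () ; at-injective = λ {} ; at-∈ = λ () ; index = λ () ; at-index = λ () }
enumerate {suc n} p with p zero in eq | enumerate (p ∘ suc)
... | true  | E = record
  { at           = λ { zero → zero ; (suc i) → suc (at i) }
  ; at-injective = λ { {zero} {zero} _ → refl ; {suc i} {suc j} h → cong suc (at-injective (Fin.suc-injective h)) }
  ; at-∈         = λ { zero → Equivalence.from T-≡ eq ; (suc i) → at-∈ i }
  ; index        = λ { zero _ → zero ; (suc j) h → suc (index j h) }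
  ; at-index     = λ { zero _ → refl ; (suc j) h → cong suc (at-index j h) }
  }
  where open Enumeration E
... | false | E = record
  { at           = suc ∘ at
  ; at-injective = at-injective ∘ Fin.suc-injective
  ; at-∈         = at-∈
  ; index        = λ { zero h → ⊥-elim (subst T eq h) ; (suc j) h → index j h }
  ; at-index     = λ { zero h → ⊥-elim (subst T eq h) ; (suc j) h → cong suc (at-index j h) }
  }
  where open Enumeration E

Idx↔ : ∀ k → Fin (suc (suc k + suc k * k)) ↔ Idx k
Idx↔ k = ↔-trans (Fin.+↔⊎ {1}) (Fin.1↔⊤ ⊎-↔ ↔-trans (Fin.+↔⊎ {suc k}) (↔-refl ⊎-↔ Fin.*↔× {suc k}))

∑-⊎ : ∀ m {n} (f : Fin m ⊎ Fin n → ℤ) →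
      ∑ (m + n) (f ∘ splitAt m) ≡ ∑ m (f ∘ inj₁) ℤ.+ ∑ n (f ∘ inj₂)
∑-⊎ zero    f = sym (ℤ.+-identityˡ _)
∑-⊎ (suc m) f = trans (cong (ℤ._+_ (f (inj₁ zero))) (trans (∑-cong shift) (∑-⊎ m (f ∘ ⊎-map suc (λ j → j)))))
  (sym (ℤ.+-assoc (f (inj₁ zero)) _ _))
  where
  shift : ∀ i → f (splitAt (suc m) (suc i)) ≡ f (⊎-map suc (λ j → j) (splitAt m i))
  shift i = refl

∑-× : ∀ m {n} (f : Fin m × Fin n → ℤ) → ∑ (m * n) (f ∘ remQuot n) ≡ ∑ m (λ i → ∑ n (λ a → f (i , a)))
∑-× zero        f = refl
∑-× (suc m) {n} f = trans (∑-cong {suc m * n} step) (trans (∑-⊎ n [ (λ a → f (zero , a)) , (λ j → f (map₁ suc (remQuot n j))) ]′)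
  (cong (ℤ._+_ (∑ n (λ a → f (zero , a)))) (∑-× m (f ∘ map₁ suc))))
  where
  step : ∀ i → f (remQuot {suc m} n i) ≡ [ (λ a → f (zero , a)) , (λ j → f (map₁ suc (remQuot n j))) ]′ (splitAt n i)
  step i with splitAt n i
  ... | inj₁ a = refl
  ... | inj₂ j = refl

∑-Idx : ∀ {n k} (σ : Fin n ↔ Idx k) (f : Idx k → ℤ) →
        ∑ n (f ∘ Inverse.to σ) ≡ f (inj₁ tt) ℤ.+ (∑ (suc k) (λ i → f (inj₂ (inj₁ i)))
                                   ℤ.+ ∑ (suc k) (λ i → ∑ k (λ a → f (inj₂ (inj₂ (i , a))))))
∑-Idx {n} {k} σ f = begin
  ∑ n (f ∘ Inverse.to σ)
    ≡⟨ ∑-permute (f ∘ Inverse.to σ) π ⟨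
  ∑ (suc (suc k + suc k * k)) (λ i → f (Inverse.to σ (π ⟨$⟩ʳ i)))
    ≡⟨ ∑-cong {suc (suc k + suc k * k)} (λ i → cong f (Inverse.strictlyInverseˡ σ (Inverse.to (Idx↔ k) i))) ⟩
  f (inj₁ tt) ℤ.+ ∑ (suc k + suc k * k) (f ∘ inj₂ ∘ ⊎-map (λ i → i) (remQuot k) ∘ splitAt (suc k))
    ≡⟨ cong (ℤ._+_ (f (inj₁ tt))) (∑-⊎ (suc k) (f ∘ inj₂ ∘ ⊎-map (λ i → i) (remQuot k))) ⟩
  f (inj₁ tt) ℤ.+ (∑ (suc k) (λ i → f (inj₂ (inj₁ i))) ℤ.+ ∑ (suc k * k) (f ∘ inj₂ ∘ inj₂ ∘ remQuot k))
    ≡⟨ cong (λ s → f (inj₁ tt) ℤ.+ (∑ (suc k) (λ i → f (inj₂ (inj₁ i))) ℤ.+ s)) (∑-× (suc k) (f ∘ inj₂ ∘ inj₂)) ⟩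
  f (inj₁ tt) ℤ.+ (∑ (suc k) (λ i → f (inj₂ (inj₁ i))) ℤ.+ ∑ (suc k) (λ i → ∑ k (λ a → f (inj₂ (inj₂ (i , a)))))) ∎
  where
  open ≡-Reasoning
  π : Permutation (suc (suc k + suc k * k)) n
  π = ↔-trans (Idx↔ k) (↔-sym σ)

-- Both sides have κ² + 1 elements, so an injective `ρ` is a bijection, and its inverse serves as
-- the relabelling.
invert : ∀ {k} (ρ : Idx k → Fin (suc (suc k * suc k))) → Injective _≡_ _≡_ ρ →
         Σ (Fin (suc (suc k * suc k)) ↔ Idx k) λ σ → ∀ x → ρ (Inverse.to σ x) ≡ x
invert {k} ρ ρ-injective = ↔-trans (↔-sym π) e , inverse
  where
  e : Fin (suc (suc k * suc k)) ↔ Idx k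
  e = ↔-trans (Perm.cast-id (cong suc (ℕ.*-suc (suc k) k))) (Idx↔ k)

  extended : Σ (Permutation _ _) λ π → ∀ i → π ⟨$⟩ʳ inject≤ i ℕ.≤-refl ≡ ρ (Inverse.to e i)
  extended = extend (ρ ∘ Inverse.to e) (to-injective e ∘ ρ-injective) ℕ.≤-refl

  π = proj₁ extended

  inverse : ∀ x → ρ (Inverse.to e (π ⟨$⟩ˡ x)) ≡ x
  inverse x = trans (sym (proj₂ extended (π ⟨$⟩ˡ x)))
    (trans (cong (π ⟨$⟩ʳ_) (Fin.inject≤-refl (π ⟨$⟩ˡ x) ℕ.≤-refl)) (inverseʳ π))

-- The standard form around a triangle-free vertex

module _ {k : ℕ} (A : Mat (Fin (suc (suc k * suc k)))) (A-sym : ∀ u v → A u v ≡ A v u) (bin : ∀ u v → Is01 (A u v))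
         (rows : ∀ u → ∑ (suc (suc k * suc k)) (A u) ≡ + suc k)
         (G : Graph (suc (suc k * suc k)) (suc k))
         (A⇒~ : ∀ {u v} → A u v ≡ 1ℤ → Graph._~_ G u v) (~⇒A : ∀ {u v} → Graph._~_ G u v → A u v ≡ 1ℤ)
         (v : Fin (suc (suc k * suc k))) (free : ∀ a b → ¬ Graph.Triangle G v a b) where
  open Graph G

  private
    neighbours : ∀ u → Enumeration (adj u) (suc k)
    neighbours u = subst (Enumeration (adj u)) (regular u) (enumerate (adj u))

    module N u = Enumeration (neighbours u)

    c : Fin (suc k) → Fin (suc (suc k * suc k))
    c = N.at v

    v~c : ∀ i → v ~ c i
    v~c = N.at-∈ v

    -- The position of the centre `v` among the κ neighbours of `c i`. Skipping it with `punchIn`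
    -- leaves the κ - 1 leaves of block i.
    root : ∀ i → Fin (suc k)
    root i = N.index (c i) v (~-sym (v~c i))

    leaf : Fin (suc k) → Fin k → Fin (suc (suc k * suc k))
    leaf i a = N.at (c i) (punchIn (root i) a)

    c~leaf : ∀ i a → c i ~ leaf i a
    c~leaf i a = N.at-∈ (c i) (punchIn (root i) a)

    ~⇒≢ : ∀ {u w} → u ~ w → u ≢ w
    ~⇒≢ u~w refl = ~-irrefl u~w

    v≢leaf : ∀ {i a} → v ≢ leaf i a
    v≢leaf {i} {a} eq = Fin.punchInᵢ≢i (root i) a
      (N.at-injective (c i) (trans (sym eq) (sym (N.at-index (c i) v (~-sym (v~c i))))))

    c≁c : ∀ i j → ¬ c i ~ c j
    c≁c i j h = free (c i) (c j) (v~c i , v~c j , h)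

    v≁leaf : ∀ i a → ¬ v ~ leaf i a
    v≁leaf i a h = free (c i) (leaf i a) (v~c i , h , c~leaf i a)

    c≁leaf : ∀ {i j} b → i ≢ j → ¬ c i ~ leaf j b
    c≁leaf {i} {j} b i≢j h = noSquare (i≢j ∘ N.at-injective v) v≢leaf (~-sym (v~c i)) h (~-sym (v~c j)) (c~leaf j b)

    leaf-injective : ∀ {i j a b} → leaf i a ≡ leaf j b → (i , a) ≡ (j , b)
    leaf-injective {i} {j} {a} {b} eq with i ≟ j
    ... | yes refl = cong (i ,_) (Fin.punchIn-injective (root i) a b (N.at-injective (c i) eq))
    ... | no i≢j   = contradiction (subst (c i ~_) eq (c~leaf i a)) (c≁leaf b i≢j)

    ρ : Idx k → Fin (suc (suc k * suc k))
    ρ (inj₁ _)              = v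
    ρ (inj₂ (inj₁ i))       = c i
    ρ (inj₂ (inj₂ (i , a))) = leaf i a

    ρ-injective : Injective _≡_ _≡_ ρ
    ρ-injective {inj₁ _}        {inj₁ _}        _  = refl
    ρ-injective {inj₁ _}        {inj₂ (inj₁ j)} eq = contradiction eq (~⇒≢ (v~c j))
    ρ-injective {inj₁ _}        {inj₂ (inj₂ _)} eq = contradiction eq v≢leaf
    ρ-injective {inj₂ (inj₁ i)} {inj₁ _}        eq = contradiction (sym eq) (~⇒≢ (v~c i))
    ρ-injective {inj₂ (inj₁ i)} {inj₂ (inj₁ j)} eq = cong (inj₂ ∘ inj₁) (N.at-injective v eq)
    ρ-injective {inj₂ (inj₁ i)} {inj₂ (inj₂ (j , b))} eq = contradiction (subst (v ~_) eq (v~c i)) (v≁leaf j b)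
    ρ-injective {inj₂ (inj₂ _)} {inj₁ _}        eq = contradiction (sym eq) v≢leaf
    ρ-injective {inj₂ (inj₂ (i , a))} {inj₂ (inj₁ j)} eq = contradiction (subst (v ~_) (sym eq) (v~c j)) (v≁leaf i a)
    ρ-injective {inj₂ (inj₂ _)} {inj₂ (inj₂ _)} eq = cong (inj₂ ∘ inj₂) (leaf-injective eq)

    ≁⇒A : ∀ {u w} → ¬ u ~ w → A u w ≡ 0ℤ
    ≁⇒A {u} {w} h with bin u w
    ... | inj₁ eq = eq
    ... | inj₂ eq = contradiction (A⇒~ eq) h

    P : BlockMat k
    P i a j b = A (leaf i a) (leaf j b)

    spoke : ∀ i j b → A (c i) (leaf j b) ≡ δ i j
    spoke i j b with i ≟ j
    ... | yes refl = ~⇒A (c~leaf i b)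
    ... | no i≢j   = ≁⇒A (c≁leaf b i≢j)

    entries : ∀ p q → A (ρ p) (ρ q) ≡ S P p q
    entries (inj₁ _)              (inj₁ _)              = ≁⇒A ~-irrefl
    entries (inj₁ _)              (inj₂ (inj₁ j))       = ~⇒A (v~c j)
    entries (inj₁ _)              (inj₂ (inj₂ (j , b))) = ≁⇒A (v≁leaf j b)
    entries (inj₂ (inj₁ i))       (inj₁ _)              = ~⇒A (~-sym (v~c i))
    entries (inj₂ (inj₁ i))       (inj₂ (inj₁ j))       = ≁⇒A (c≁c i j)
    entries (inj₂ (inj₁ i))       (inj₂ (inj₂ (j , b))) = spoke i j b
    entries (inj₂ (inj₂ (i , a))) (inj₁ _)              = ≁⇒A (v≁leaf i a ∘ ~-sym)
    entries (inj₂ (inj₂ (i , a))) (inj₂ (inj₁ j))       = trans (A-sym (leaf i a) (c j)) (spoke j i a)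
    entries (inj₂ (inj₂ _))       (inj₂ (inj₂ _))       = refl

    σ : Fin (suc (suc k * suc k)) ↔ Idx k
    σ = proj₁ (invert ρ ρ-injective)

    ρσ : ∀ x → ρ (Inverse.to σ x) ≡ x
    ρσ = proj₂ (invert ρ ρ-injective)

    row-sum : ∀ i a → ∑ (suc k) (λ j → ∑ k (λ b → P i a j b)) ≡ + k
    -- Of the row sum κ of a leaf, the centre contributes 0 and the part in `K` contributes 1.
    row-sum i a = ∙-cancelˡ 1ℤ _ _ (begin
      1ℤ ℤ.+ rest                                                  ≡⟨ cong (ℤ._+ rest) (trans (∑-cong (λ j → δ-sym j i)) (∑-δ i)) ⟨
      ∑ (suc k) (λ j → δ j i) ℤ.+ rest                             ≡⟨ ℤ.+-identityˡ _ ⟨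
      0ℤ ℤ.+ (∑ (suc k) (λ j → δ j i) ℤ.+ rest)                    ≡⟨ ∑-Idx σ (S P (inj₂ (inj₂ (i , a)))) ⟨
      ∑ (suc (suc k * suc k)) (S P (inj₂ (inj₂ (i , a))) ∘ Inverse.to σ)
        ≡⟨ ∑-cong (λ x → trans (sym (entries (inj₂ (inj₂ (i , a))) (Inverse.to σ x))) (cong (A (leaf i a)) (ρσ x))) ⟩
      ∑ (suc (suc k * suc k)) (A (leaf i a))                       ≡⟨ rows (leaf i a) ⟩
      + suc k                                                      ∎)
      where
      open ≡-Reasoning
      rest = ∑ (suc k) (λ j → ∑ k (λ b → P i a j b))

    P-sym : ∀ i a j b → P i a j b ≡ P j b i a
    P-sym i a j b = A-sym (leaf i a) (leaf j b)

    -- Two ones would give `leaf i a` and `c j` two common neighbours in block j. These two vertices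
    -- differ, since only `c j` is adjacent to `v`.
    one-per-row : ∀ i j a b b′ → P i a j b ≡ 1ℤ → P i a j b′ ≡ 1ℤ → b ≡ b′
    one-per-row i j a b b′ h h′ with b ≟ b′
    ... | yes eq  = eq
    ... | no b≢b′ = ⊥-elim (noSquare
      (λ eq → v≁leaf i a (subst (v ~_) eq (v~c j)))
      (λ eq → b≢b′ (cong proj₂ (leaf-injective eq)))
      (c~leaf j b) (c~leaf j b′) (A⇒~ h) (A⇒~ h′))

  standard-form : Σ (BlockMat k) λ P → IsStdP P × BlocksPartialPerm P × PEquiv A (S P)
  standard-form = P
    , ( (λ i a j b → bin (leaf i a) (leaf j b))
      , P-sym
      , row-sum
      , (λ j b → trans (∑-cong (λ i → ∑-cong (λ a → P-sym i a j b))) (row-sum j b)))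
    , (one-per-row , λ i j a a′ b h h′ → one-per-row j i b a a′ (trans (P-sym j b i a) h) (trans (P-sym j b i a′) h′))
    , (σ , λ x y → trans (sym (cong₂ A (ρσ x) (ρσ y))) (entries (Inverse.to σ x) (Inverse.to σ y)))

-- Zero blocks and normalisation

≤1-unique : ∀ {n} (f : Fin n → ℤ) → (∀ b → Is01 (f b)) → (∀ b b′ → f b ≡ 1ℤ → f b′ ≡ 1ℤ → b ≡ b′) → ∑ n f ℤ.≤ 1ℤ
≤1-unique {n} f bin unique with Fin.any? (λ b → f b ℤ.≟ 1ℤ)
... | yes (b , fb) = ℤ.≤-trans (∑-mono bound) (ℤ.≤-reflexive (∑-δ b))
  where
  bound : ∀ c → f c ℤ.≤ δ b c
  bound c with b ≟ c | bin c
  ... | yes refl | _       = ℤ.≤-reflexive fb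
  ... | no _     | inj₁ fc = ℤ.≤-reflexive fc
  ... | no b≢c   | inj₂ fc = contradiction (unique b c fb fc) b≢c
... | no none = ℤ.≤-trans (∑-mono {n} {f} {λ _ → 0ℤ} bound) (ℤ.≤-trans (ℤ.≤-reflexive (∑-0 n)) (ℤ.+≤+ z≤n))
  where
  bound : ∀ c → f c ℤ.≤ 0ℤ
  bound c with bin c
  ... | inj₁ fc = ℤ.≤-reflexive fc
  ... | inj₂ fc = contradiction (c , fc) none

perm-matrix : ∀ {n} (M : Fin n → Fin n → ℤ) → (∀ a b → Is01 (M a b)) →
              (∀ a → ∃ λ b → M a b ≡ 1ℤ) → (∀ a b b′ → M a b ≡ 1ℤ → M a b′ ≡ 1ℤ → b ≡ b′) →
              (∀ a a′ b → M a b ≡ 1ℤ → M a′ b ≡ 1ℤ → a ≡ a′) → IsPermMat M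
perm-matrix {n} M bin total rowUnique columnUnique = π , entries
  where
  f : Fin n → Fin n
  f a = proj₁ (total a)

  f-injective : Injective _≡_ _≡_ f
  f-injective {a} {a′} eq = columnUnique a a′ (f a) (proj₂ (total a)) (trans (cong (M a′) eq) (proj₂ (total a′)))

  extended : Σ (Permutation n n) λ π → ∀ a → π ⟨$⟩ʳ inject≤ a ℕ.≤-refl ≡ f a
  extended = extend f f-injective ℕ.≤-refl

  π = proj₁ extended

  π≗f : ∀ a → π ⟨$⟩ʳ a ≡ f a
  π≗f a = trans (cong (π ⟨$⟩ʳ_) (sym (Fin.inject≤-refl a ℕ.≤-refl))) (proj₂ extended a)

  entries : ∀ a b → M a b ≡ δ (π ⟨$⟩ʳ a) b
  entries a b with π ⟨$⟩ʳ a ≟ b | bin a b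
  ... | yes refl | _      = trans (cong (M a) (π≗f a)) (proj₂ (total a))
  ... | no _     | inj₁ h = h
  ... | no πa≢b  | inj₂ h = contradiction (trans (π≗f a) (rowUnique a (f a) b (proj₂ (total a)) h)) πa≢b

perm-transpose : ∀ {n} {M : Fin n → Fin n → ℤ} → IsPermMat M → IsPermMat (λ a b → M b a)
perm-transpose (π , entries) = ↔-sym π , λ a b → trans (entries b a)
  (trans (cong (δ (π ⟨$⟩ʳ b)) (sym (inverseʳ π)))
    (trans (δ-injective (π ⟨$⟩ʳ_) (to-injective π) b (π ⟨$⟩ˡ a)) (δ-sym b (π ⟨$⟩ˡ a))))

module _ {k : ℕ} (P : BlockMat k) (std : IsStdP P) (partialPerm : BlocksPartialPerm P) where
  private
    bin = proj₁ std
    P-sym = proj₁ (proj₂ std)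
    row-sum = proj₁ (proj₂ (proj₂ std))

  zero-block-row : ∀ {i j} → ZeroBlock P i j → ∀ j′ → j′ ≢ j → IsPermMat (λ a b → P i a j′ b)
  zero-block-row {i} {j} zeros j′ j′≢j =
    perm-matrix (λ a b → P i a j′ b) (λ a b → bin i a j′ b) total (λ a → proj₁ partialPerm i j′ a)
      (λ a a′ b → proj₂ partialPerm i j′ a a′ b)
    where
    -- If row a of P_ij′ vanished too, at most κ - 2 blocks could contribute
    -- to a row sum of κ - 1.
    total : ∀ a → ∃ λ b → P i a j′ b ≡ 1ℤ
    total a with Fin.any? (λ b → P i a j′ b ℤ.≟ 1ℤ)
    ... | yes found = found
    ... | no none   = contradiction bound too-large
      where
      s : Fin (suc k) → ℤ
      s l = ∑ k (λ b → P i a l b)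

      vanishes : ∀ b → P i a j′ b ≡ 0ℤ
      vanishes b with bin i a j′ b
      ... | inj₁ h = h
      ... | inj₂ h = contradiction (b , h) none

      -- Each of the two vanishing blocks leaves room for an extra 1, recorded by `δ`. Summing over
      -- all κ blocks gives (κ-1) + 2 ≤ κ.
      s+δ≤1 : ∀ l → s l ℤ.+ (δ j l ℤ.+ δ j′ l) ℤ.≤ 1ℤ
      s+δ≤1 l with j ≟ l | j′ ≟ l
      ... | yes refl | yes refl = contradiction refl j′≢j
      ... | yes refl | no _     = ℤ.≤-reflexive (cong (ℤ._+ 1ℤ) (trans (∑-cong (zeros a)) (∑-0 k)))
      ... | no _     | yes refl = ℤ.≤-reflexive (cong (ℤ._+ 1ℤ) (trans (∑-cong vanishes) (∑-0 k)))
      ... | no _     | no _     = subst (ℤ._≤ 1ℤ) (sym (ℤ.+-identityʳ (s l)))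
              (≤1-unique (λ b → P i a l b) (bin i a l) (proj₁ partialPerm i l a))

      bound : + k ℤ.+ + 2 ℤ.≤ + suc k
      bound = subst₂ ℤ._≤_
        (trans (∑-+ s (λ l → δ j l ℤ.+ δ j′ l))
          (cong₂ ℤ._+_ (row-sum i a) (trans (∑-+ (δ j) (δ j′)) (cong₂ ℤ._+_ (∑-δ j) (∑-δ j′)))))
        (∑-1 (suc k)) (∑-mono s+δ≤1)

      too-large : ¬ + k ℤ.+ + 2 ℤ.≤ + suc k
      too-large (ℤ.+≤+ h) = ℕ.<-irrefl refl (subst (_≤ suc k) (ℕ.+-comm k 2) h)

  zero-block-column : ∀ {i j} → ZeroBlock P i j → ∀ i′ → i′ ≢ i → IsPermMat (λ a b → P i′ a j b)
  zero-block-column {i} {j} zeros i′ i′≢i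
    with perm-transpose (zero-block-row {j} {i} (λ a b → trans (P-sym j a i b) (zeros b a)) i′ i′≢i)
  ... | π , entries = π , λ a b → trans (P-sym i′ a j b) (entries a b)

  module _ {i : Fin (suc k)} (zeros : ZeroBlock P i i) where
    private
      -- Brings the zero diagonal block to the front; the other blocks in its row are then
      -- permutation matrices.
      τ : Permutation (suc k) (suc k)
      τ = transpose zero i

      block : ∀ l → IsPermMat (λ a b → P i a (τ ⟨$⟩ʳ suc l) b)
      block l = zero-block-row zeros (τ ⟨$⟩ʳ suc l) τ≢i
        where
        τ≢i : τ ⟨$⟩ʳ suc l ≢ i
        τ≢i eq with to-injective τ {suc l} {zero} eq
        ... | ()

      -- Block 0 keeps its order, and each other block is renumbered by the permutation found in the
      -- first block row. This turns the entry δ (π a) b there into δ (π a) (π b) = δ a b.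
      φ : Fin (suc k) → Permutation k k
      φ zero    = ↔-refl
      φ (suc l) = proj₁ (block l)

      P′ : BlockMat k
      P′ j a l b = P (τ ⟨$⟩ʳ j) (φ j ⟨$⟩ʳ a) (τ ⟨$⟩ʳ l) (φ l ⟨$⟩ʳ b)

      leaves : (Fin (suc k) × Fin k) ↔ (Fin (suc k) × Fin k)
      leaves = mk↔ₛ′ (λ (j , a) → τ ⟨$⟩ʳ j , φ j ⟨$⟩ʳ a) (λ (j , a) → τ ⟨$⟩ˡ j , φ (τ ⟨$⟩ˡ j) ⟨$⟩ˡ a)
        (λ (j , a) → cong₂ _,_ (inverseʳ τ) (inverseʳ (φ (τ ⟨$⟩ˡ j))))
        (λ (j , a) → cong₂ _,_ (inverseˡ τ) (cancel {j} (inverseˡ τ)))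
        where
        cancel : ∀ {j l a} → l ≡ j → φ l ⟨$⟩ˡ (φ j ⟨$⟩ʳ a) ≡ a
        cancel {j} refl = inverseˡ (φ j)

      -- The middle vertices follow the same `τ` as the blocks of leaves, and `φ` acts inside
      -- blocks, on which the rows of `K` are constant; so `K` is unchanged.
      ψ : Idx k ↔ Idx k
      ψ = ↔-refl ⊎-↔ (τ ⊎-↔ leaves)

      S-relabel : ∀ p q → S P (Inverse.to ψ p) (Inverse.to ψ q) ≡ S P′ p q
      S-relabel (inj₁ _)        (inj₁ _)        = refl
      S-relabel (inj₁ _)        (inj₂ (inj₁ _)) = refl
      S-relabel (inj₁ _)        (inj₂ (inj₂ _)) = refl
      S-relabel (inj₂ (inj₁ _)) (inj₁ _)        = refl
      S-relabel (inj₂ (inj₁ _)) (inj₂ (inj₁ _)) = refl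
      S-relabel (inj₂ (inj₁ j)) (inj₂ (inj₂ (l , _))) = δ-injective (τ ⟨$⟩ʳ_) (to-injective τ) j l
      S-relabel (inj₂ (inj₂ _)) (inj₁ _)        = refl
      S-relabel (inj₂ (inj₂ (l , _))) (inj₂ (inj₁ j)) = δ-injective (τ ⟨$⟩ʳ_) (to-injective τ) j l
      S-relabel (inj₂ (inj₂ _)) (inj₂ (inj₂ _)) = refl

      row-sum′ : ∀ j a → ∑ (suc k) (λ l → ∑ k (λ b → P′ j a l b)) ≡ + k
      row-sum′ j a =
        trans (∑-cong (λ l → ∑-permute (λ b → P (τ ⟨$⟩ʳ j) (φ j ⟨$⟩ʳ a) (τ ⟨$⟩ʳ l) b) (φ l)))
          (trans (∑-permute (λ l → ∑ k (λ b → P (τ ⟨$⟩ʳ j) (φ j ⟨$⟩ʳ a) l b)) τ) (row-sum _ _))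

      P′-sym : ∀ j a l b → P′ j a l b ≡ P′ l b j a
      P′-sym j a l b = P-sym _ _ _ _

      id-row : ∀ l → IdBlock P′ zero (suc l)
      id-row l a b = trans (proj₂ (block l) a (φ (suc l) ⟨$⟩ʳ b))
        (δ-injective (φ (suc l) ⟨$⟩ʳ_) (to-injective (φ (suc l))) a b)

    normalise : ∀ {n} {A : Mat (Fin n)} → PEquiv A (S P) →
                Σ (BlockMat k) λ P′ → (IsStdP P′ × PEquiv A (S P′) × ZeroBlock P′ zero zero
                  × (∀ (i : Fin k) → IdBlock P′ zero (suc i) × IdBlock P′ (suc i) zero))
    normalise (σ , A≡S) = P′
      , ( (λ j a l b → bin _ _ _ _) , P′-sym , row-sum′
        , (λ l b → trans (∑-cong (λ j → ∑-cong (λ a → P′-sym j a l b))) (row-sum′ l b)))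
      , (↔-trans σ (↔-sym ψ) , λ x y → trans (A≡S x y)
          (trans (sym (cong₂ (S P) (Inverse.strictlyInverseˡ ψ (Inverse.to σ x)) (Inverse.strictlyInverseˡ ψ (Inverse.to σ y))))
            (S-relabel (Inverse.from ψ (Inverse.to σ x)) (Inverse.from ψ (Inverse.to σ y)))))
      , zeros
      , (λ l → id-row l , λ a b → trans (P′-sym (suc l) a zero b) (trans (id-row l b a) (δ-sym b a)))

theorem3p5 : (k : ℕ) → k ≤ 3 →
    (A : Fin (suc (suc k * suc k)) → Fin (suc (suc k * suc k)) → ℤ) →
    (∀ i j → Is01 (A i j)) →
    (∀ i → ∑ (suc (suc k * suc k)) (λ j → A i j) ≡ + suc k) →
    (∀ j → ∑ (suc (suc k * suc k)) (λ i → A i j) ≡ + suc k) →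
    (Σ ℕ λ m → (1 ≤ m × (∀ i j → Θ^ m A i j ≡ A i j))) →
    (Σ (BlockMat k) λ P → (IsStdP P × BlocksPartialPerm P × PEquiv A (S P)))
    × (∀ (P : BlockMat k) → IsStdP P → BlocksPartialPerm P → PEquiv A (S P) →
    ∀ i j → ZeroBlock P i j →
    (∀ j′ → j′ ≢ j → IsPermMat (λ a b → P i a j′ b))
    × (∀ i′ → i′ ≢ i → IsPermMat (λ a b → P i′ a j b)))
    × (∀ (P : BlockMat k) → IsStdP P → BlocksPartialPerm P → PEquiv A (S P) →
    (Σ (Fin (suc k)) λ i → ZeroBlock P i i) →
    Σ (BlockMat k) λ P′ → (IsStdP P′ × PEquiv A (S P′) × ZeroBlock P′ zero zero
    × (∀ (i : Fin k) → IdBlock P′ zero (suc i) × IdBlock P′ (suc i) zero)))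
theorem3p5 k k≤3 A bin rows cols (m , 1≤m , periodic) =
    standard-form A (A-sym k A rows cols bin 1≤m periodic) bin rows G fromWitness toWitness (proj₁ vertex) (proj₂ vertex)
  , (λ P std pp _ i j zeros → zero-block-row P std pp zeros , zero-block-column P std pp zeros)
  , (λ P std pp equiv (i , zeros) → normalise P std pp zeros equiv)
  where
  G      = graph k A rows cols bin 1≤m periodic
  vertex = triangle-free-vertex k k≤3 G
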